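{- There exist absolute constants $C>0$ and $t_0$ such that for every integer $t\ge t_0$, and all integers $s,n$ with $2t\le s\le n/2$ and $n$ sufficiently large, there exists a graph $G$ on $n$ vertices with independence number $$\alpha(G)\le C\, t\left(\frac{n}{s}\right)^{2t/(s-t)}\log(n/t)$$ such that every induced subgraph of $G$ on $s$ vertices contains an independent set of size $t$.
   Context: $\alpha(G)$ denotes the maximum size of an independent set in $G$. All logarithms are natural logarithms. -}

module Defs where

open import Data.Nat as ℕ using (ℕ; zero; suc)
open import Data.Integer using (+_)
open import Data.Rational as ℚ using (ℚ; _/_; 0ℚ; 1ℚ)
open import Data.Fin using (Fin)
open import Data.Fin.Subset using (Subset; _∈_; _⊆_; ∣_∣)
open import Data.Product using (Σ; ∃; _×_)
open import Relation.Nullary using (¬_)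
open import Relation.Binary.PropositionalEquality using (_≡_)

record Graph (n : ℕ) : Set₁ where
  field
    Adj     : Fin n → Fin n → Set
    sym     : ∀ {u v} → Adj u v → Adj v u
    irrefl  : ∀ {u} → ¬ Adj u u

open Graph public

⟦_⟧ : ℕ → ℚ
⟦ k ⟧ = + k / 1

_^ℚ_ : ℚ → ℕ → ℚ
q ^ℚ zero  = 1ℚ
q ^ℚ suc k = q ℚ.* (q ^ℚ k)

expTerm : ℕ → ℚ → ℚ
expTerm zero    x = 1ℚ
expTerm (suc k) x = (expTerm k x ℚ.* x) ℚ.* ((+ 1) / suc k)

expPartial : ℕ → ℚ → ℚ
expPartial zero    x = 1ℚ
expPartial (suc N) x = expPartial N x ℚ.+ expTerm (suc N) x

-- For r ≥ 0 and s > t:  (n/s)^(2t/(s-t)) ≤ r   ⟺   n^(2t) ≤ r^(s-t) · s^(2t)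
PowBoundLE : (n s t : ℕ) → ℚ → Set
PowBoundLE n s t r =
  (0ℚ ℚ.≤ r) × (⟦ n ⟧ ^ℚ (2 ℕ.* t) ℚ.≤ (r ^ℚ (s ℕ.∸ t)) ℚ.* (⟦ s ⟧ ^ℚ (2 ℕ.* t)))

-- For ℓ ≥ 0 and t ≥ 1:  log(n/t) ≤ ℓ witnessed by a partial sum of exp(ℓ) reaching n/t,
-- i.e. ∃ N, n ≤ t · Σ_{k≤N} ℓ^k/k!.
LogBoundLE : (n t : ℕ) → ℚ → Set
LogBoundLE n t ℓ =
  (0ℚ ℚ.≤ ℓ) × ∃ λ N → ⟦ n ⟧ ℚ.≤ ⟦ t ⟧ ℚ.* expPartial N ℓ

-- The real number  X = C · t · (n/s)^(2t/(s-t)) · log(n/t)  is strictly below k.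
-- (Equivalent, for s > t and n > t, to the existence of rational upper bounds r, ℓ of the
--  power and of the logarithm with C·t·r·ℓ < k.)
BoundBelow : (C : ℚ) (n s t k : ℕ) → Set
BoundBelow C n s t k =
  ∃ λ r → ∃ λ ℓ → PowBoundLE n s t r × LogBoundLE n t ℓ ×
    (((C ℚ.* ⟦ t ⟧) ℚ.* r) ℚ.* ℓ ℚ.< ⟦ k ⟧)

Independent : ∀ {n} → Graph n → Subset n → Set
Independent G I = ∀ u v → u ∈ I → v ∈ I → ¬ Adj G u v

AlphaBound : (C : ℚ) (n s t : ℕ) → Graph n → Set
AlphaBound C n s t G = ∀ I → Independent G I → ¬ BoundBelow C n s t ∣ I ∣

EverySSetHasIndepT : ∀ {n} → Graph n → (s t : ℕ) → Set
EverySSetHasIndepT G s t =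
  ∀ S → ∣ S ∣ ≡ s → ∃ λ I → I ⊆ S × Independent G I × ∣ I ∣ ≡ t

{-# OPTIONS --safe #-}

-- Take the random graph with edge probability 1/q, where q = 2 t l and l is the least integer with
-- l ≥ 256 (n/s)^(2t/(s-t)).  By Turán's theorem an s-set without an independent t-set spans at least
-- s(s-t)/2t edges, and weighting each s-set by l^(number of its edges) makes such sets visible to the first
-- moment: by the choice of l the expected total weight is at most half the weight of a single one.  With g the
-- least integer such that 2^g ≥ 16 n/t, the expected number of independent sets of size 2 g q + 1 is at
-- most 1/4.  So some graph has neither.
module Submission where

open import Defs hiding (sym)
open import Data.Bool using (Bool; true; false; if_then_else_)
open import Data.Fin using (Fin; zero; suc)
open import Data.Fin.Subset using (Subset; ∣_∣; _∩_; inside; outside; ⊥; ⊤; _∈_; _⊆_)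
open import Data.Fin.Subset.Properties
  using (∩-zeroˡ; ∩-identityʳ; ∣⊥∣≡0; ⊥⊆; s⊆s; in⊆in; out⊆; ⊆-trans)
import Data.Integer as ℤ
import Data.Integer.Properties as ℤ
open import Data.List using (List; []; _∷_; map)
open import Data.List.Relation.Unary.All as All using (All; []; _∷_)
open import Data.List.Relation.Unary.All.Properties using (gmap⁺; ¬Any⇒All¬)
open import Data.List.Relation.Unary.Any using (any?)
open import Data.Nat
open import Data.Nat.ListAction using (sum)
open import Data.Nat.Properties
open import Data.Nat.Tactic.RingSolver using (solve-∀)
open import Data.Product using (Σ; ∃; _×_; _,_; proj₁; proj₂; uncurry)
open import Data.Rational as ℚ using (ℚ; mkℚ; 0ℚ; 1ℚ; toℚᵘ)
import Data.Rational.Properties as ℚ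
open import Data.Rational.Solver using (module +-*-Solver)
open import Data.Rational.Unnormalised as ℚᵘ using (mkℚᵘ; *≡*; *≤*; *<*)
import Data.Rational.Unnormalised.Properties as ℚᵘ
open import Data.Sum using (_⊎_; inj₁; inj₂)
open import Data.Vec using (Vec; []; _∷_; here; there)
open import Function using (_∘_)
open import Relation.Binary.PropositionalEquality
open import Relation.Nullary using (¬_; Dec; yes; no; contradiction)
open +-*-Solver using (solve; _:=_; _:+_; _:*_; con)

-- Inequalities for powers and factorials

suc-^-≤ : ∀ m k → suc m ^ suc k ≤ m ^ suc k + suc k * suc m ^ k
suc-^-≤ m zero = ≤-reflexive (eq m)
  where
  eq : ∀ m → suc m * 1 ≡ m * 1 + 1 * 1
  eq = solve-∀
suc-^-≤ m (suc k) = begin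
  suc m * suc m ^ suc k                                         ≡⟨⟩
  suc m ^ suc k + m * suc m ^ suc k
    ≤⟨ +-monoʳ-≤ (suc m ^ suc k) (*-monoʳ-≤ m (suc-^-≤ m k)) ⟩
  suc m ^ suc k + m * (m ^ suc k + suc k * suc m ^ k)
    ≤⟨ m≤m+n _ (suc k * suc m ^ k) ⟩
  suc m ^ suc k + m * (m ^ suc k + suc k * suc m ^ k) + suc k * suc m ^ k
    ≡⟨ eq m (suc k) (m ^ suc k) (suc m ^ k) ⟩
  m * m ^ suc k + suc (suc k) * suc m ^ suc k ∎
  where
  open ≤-Reasoning
  eq : ∀ m k x y → suc m * y + m * (x + k * y) + k * y ≡ m * x + suc k * (suc m * y)
  eq = solve-∀

-- The increment of `x^(k+1)` on `[m, m+1]` is at least its derivative at the left end; `suc-^-≤` is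
-- the counterpart with the right end.
bernoulli : ∀ m k → m ^ suc k + suc k * m ^ k ≤ suc m ^ suc k
bernoulli m zero = ≤-reflexive (eq m)
  where
  eq : ∀ m → m * 1 + 1 * 1 ≡ suc m * 1
  eq = solve-∀
bernoulli m (suc k) = begin
  m * m ^ suc k + suc (suc k) * m ^ suc k
    ≤⟨ m≤m+n _ (suc k * m ^ k) ⟩
  m * m ^ suc k + suc (suc k) * m ^ suc k + suc k * m ^ k
    ≡⟨ eq m (suc k) (m ^ k) ⟩
  suc m * (m ^ suc k + suc k * m ^ k)
    ≤⟨ *-monoʳ-≤ (suc m) (bernoulli m k) ⟩
  suc m * suc m ^ suc k ∎
  where
  open ≤-Reasoning
  eq : ∀ m k y → m * (m * y) + suc k * (m * y) + k * y ≡ suc m * (m * y + k * y)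
  eq = solve-∀

-- Bernoulli's inequality in the form `(1 - 1/(m+1))^k ≥ 1 - k/(m+1) ≥ 1/2`.
suc-^-≤-2* : ∀ m k → 2 * k ≤ suc m → suc m ^ k ≤ 2 * m ^ k
suc-^-≤-2* m zero _ = s≤s z≤n
suc-^-≤-2* m (suc k) 2k≤ = +-cancelʳ-≤ (suc m ^ suc k) _ _ (begin
  suc m ^ suc k + suc m ^ suc k
    ≡⟨ eq₁ (suc m ^ suc k) ⟩
  2 * suc m ^ suc k
    ≤⟨ *-monoʳ-≤ 2 (suc-^-≤ m k) ⟩
  2 * (m ^ suc k + suc k * suc m ^ k)
    ≡⟨ eq₂ (m ^ suc k) (suc k) (suc m ^ k) ⟩
  2 * m ^ suc k + 2 * suc k * suc m ^ k
    ≤⟨ +-monoʳ-≤ (2 * m ^ suc k) (*-monoˡ-≤ (suc m ^ k) 2k≤) ⟩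
  2 * m ^ suc k + suc m ^ suc k ∎)
  where
  open ≤-Reasoning
  eq₁ : ∀ x → x + x ≡ 2 * x
  eq₁ = solve-∀
  eq₂ : ∀ x k y → 2 * (x + k * y) ≡ 2 * x + 2 * k * y
  eq₂ = solve-∀

-- With `q = suc m` this is `(1 - 1/q)^q ≤ 1/2`: any `q` pairs are simultaneously non-edges with
-- probability at most one half.
2*-^-≤-suc : ∀ m → 2 * m ^ suc m ≤ suc m ^ suc m
2*-^-≤-suc m = begin
  2 * (m * m ^ m)                  ≤⟨ m≤m+n _ (m ^ m) ⟩
  2 * (m * m ^ m) + m ^ m          ≡⟨ eq m (m ^ m) ⟩
  m * m ^ m + suc m * m ^ m        ≤⟨ bernoulli m m ⟩
  suc m ^ suc m ∎
  where
  open ≤-Reasoning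
  eq : ∀ m y → 2 * (m * y) + y ≡ m * y + suc m * y
  eq = solve-∀

-- Divided by `(k+1)!`, `suc-^-≤` bounds `f m k = m^k / k!` by the recurrence
-- `f (m+1) (k+1) ≤ f m (k+1) + f (m+1) k`, which `2^(m+k)` satisfies with equality.
^≤2^*! : ∀ m k → m ^ k ≤ 2 ^ (m + k) * k !
^≤2^*! m zero = *-mono-≤ (m^n>0 2 (m + 0)) (≤-refl {1})
^≤2^*! zero (suc k) = z≤n
^≤2^*! (suc m) (suc k) = begin
  suc m ^ suc k
    ≤⟨ suc-^-≤ m k ⟩
  m ^ suc k + suc k * suc m ^ k
    ≤⟨ +-mono-≤ (^≤2^*! m (suc k)) (*-monoʳ-≤ (suc k) (^≤2^*! (suc m) k)) ⟩
  2 ^ (m + suc k) * (suc k * k !) + suc k * (2 ^ (suc m + k) * k !)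
    ≡⟨ cong (λ e → 2 ^ (m + suc k) * (suc k * k !) + suc k * (2 ^ e * k !)) (+-suc m k) ⟨
  2 ^ (m + suc k) * (suc k * k !) + suc k * (2 ^ (m + suc k) * k !)
    ≡⟨ eq (2 ^ (m + suc k)) (suc k) (k !) ⟩
  2 ^ (suc m + suc k) * (suc k * k !) ∎
  where
  open ≤-Reasoning
  eq : ∀ x k y → x * (k * y) + k * (x * y) ≡ 2 * x * (k * y)
  eq = solve-∀

^-distribʳ-* : ∀ m n k → (m * n) ^ k ≡ m ^ k * n ^ k
^-distribʳ-* m n zero = refl
^-distribʳ-* m n (suc k) = begin
  m * n * (m * n) ^ k       ≡⟨ cong (m * n *_) (^-distribʳ-* m n k) ⟩
  m * n * (m ^ k * n ^ k)   ≡⟨ eq m n (m ^ k) (n ^ k) ⟩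
  m * m ^ k * (n * n ^ k) ∎
  where
  open ≡-Reasoning
  eq : ∀ m n x y → m * n * (x * y) ≡ m * x * (n * y)
  eq = solve-∀

^-cancelˡ-≤ : ∀ {x y} k .{{_ : NonZero k}} → x ^ k ≤ y ^ k → x ≤ y
^-cancelˡ-≤ {x} {y} k le with x ≤? y
... | yes x≤y = x≤y
... | no  x≰y = contradiction le (<⇒≱ (^-monoˡ-< k (≰⇒> x≰y)))

^-cancelʳ-< : ∀ m {a b} .{{_ : NonZero m}} → m ^ a < m ^ b → a < b
^-cancelʳ-< m {a} {b} lt with a <? b
... | yes a<b = a<b
... | no  a≮b = contradiction lt (≤⇒≯ (^-monoʳ-≤ m (≮⇒≥ a≮b)))

n≤2^n : ∀ n → n ≤ 2 ^ n
n≤2^n zero = z≤n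
n≤2^n (suc n) = begin
  1 + n                 ≤⟨ +-mono-≤ (m^n>0 2 n) (n≤2^n n) ⟩
  2 ^ n + 2 ^ n         ≡⟨ cong (2 ^ n +_) (+-identityʳ (2 ^ n)) ⟨
  2 ^ suc n ∎
  where open ≤-Reasoning

-- An integer substitute for `c^k / k! ≤ e^c`; doubling the base before applying `^≤2^*!` cancels
-- the factor `2^k`. It serves both the binomial bound, at `c = k`, and the exponential series.
^≤4^*! : ∀ c k → c ^ k ≤ 4 ^ c * k !
^≤4^*! c k = *-cancelˡ-≤ (2 ^ k) {{m^n≢0 2 k}} (begin
  2 ^ k * c ^ k                ≡⟨ ^-distribʳ-* 2 c k ⟨
  (2 * c) ^ k                  ≤⟨ ^≤2^*! (2 * c) k ⟩
  2 ^ (2 * c + k) * k !        ≡⟨ cong (_* k !) (^-distribˡ-+-* 2 (2 * c) k) ⟩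
  2 ^ (2 * c) * 2 ^ k * k !    ≡⟨ cong (λ y → y * 2 ^ k * k !) (^-*-assoc 2 2 c) ⟨
  4 ^ c * 2 ^ k * k !          ≡⟨ eq (4 ^ c) (2 ^ k) (k !) ⟩
  2 ^ k * (4 ^ c * k !) ∎)
  where
  open ≤-Reasoning
  eq : ∀ x y z → x * y * z ≡ y * (x * z)
  eq = solve-∀

-- The stand-in for roots, logarithms and ceilings: success at `suc k` supplies the estimate that is
-- wanted, and failure at `k` keeps the integer small.
last-failure : {P : ℕ → Set} → (∀ k → Dec (P k)) → ¬ P 0 → ∀ m → P m → ∃ λ k → ¬ P k × P (suc k)
last-failure P? ¬P0 zero Pm = contradiction Pm ¬P0
last-failure P? ¬P0 (suc m) Pm with P? m
... | yes Pm′ = last-failure P? ¬P0 m Pm′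
... | no ¬Pm′ = m , ¬Pm′ , Pm

-- Measures and the random graph

-- A finite measure with weights in ℕ, given by its integral; ∑-< is the first moment method, and already
-- implies monotonicity and congruence of the integral.
record Measure (A : Set) : Set where
  field
    ∑   : (A → ℕ) → ℕ
    ∑-+ : ∀ f g → ∑ (λ x → f x + g x) ≡ ∑ f + ∑ g
    ∑-< : ∀ f g → ∑ f < ∑ g → ∃ λ x → f x < g x

  ∑-mono : ∀ {f g} → (∀ x → f x ≤ g x) → ∑ f ≤ ∑ g
  ∑-mono {f} {g} f≤g = ≮⇒≥ λ lt → let (x , gx<fx) = ∑-< g f lt in contradiction gx<fx (≤⇒≯ (f≤g x))

  ∑-cong : ∀ {f g} → (∀ x → f x ≡ g x) → ∑ f ≡ ∑ g
  ∑-cong f≡g = ≤-antisym (∑-mono (≤-reflexive ∘ f≡g)) (∑-mono (≤-reflexive ∘ sym ∘ f≡g))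

  ∑-0 : ∑ (λ _ → 0) ≡ 0
  ∑-0 = sym (+-cancelˡ-≡ (∑ λ _ → 0) 0 _ (trans (+-identityʳ _) (∑-+ (λ _ → 0) (λ _ → 0))))

  ∑-*ˡ : ∀ c f → ∑ (λ x → c * f x) ≡ c * ∑ f
  ∑-*ˡ zero    f = ∑-0
  ∑-*ˡ (suc c) f = trans (∑-+ f (λ x → c * f x)) (cong (∑ f +_) (∑-*ˡ c f))

  ∑-*ʳ : ∀ c f → ∑ (λ x → f x * c) ≡ ∑ f * c
  ∑-*ʳ c f = trans (∑-cong λ x → *-comm (f x) c) (trans (∑-*ˡ c f) (*-comm c (∑ f)))

  total : ℕ
  total = ∑ λ _ → 1

open Measure

dirac : ∀ {A} → A → Measure A
dirac a .∑ f = f a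
dirac a .∑-+ f g = refl
dirac a .∑-< f g lt = a , lt

coin : ℕ → Measure Bool
coin p .∑ f = f true + p * f false
coin p .∑-+ f g = eq p (f true) (g true) (f false) (g false)
  where
  eq : ∀ p a b c d → a + b + p * (c + d) ≡ a + p * c + (b + p * d)
  eq = solve-∀
coin p .∑-< f g lt with f true <? g true | f false <? g false
... | yes t | _ = true , t
... | no _  | yes f = false , f
... | no ¬t | no ¬f = contradiction lt (≤⇒≯ (+-mono-≤ (≮⇒≥ ¬t) (*-monoʳ-≤ p (≮⇒≥ ¬f))))

_⊗_ : ∀ {A B} → Measure A → Measure B → Measure (A × B)
(μ ⊗ ν) .∑ f = ∑ μ λ x → ∑ ν λ y → f (x , y)
(μ ⊗ ν) .∑-+ f g = trans (∑-cong μ λ x → ∑-+ ν _ _) (∑-+ μ _ _)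
(μ ⊗ ν) .∑-< f g lt =
  let (x , lt′) = ∑-< μ _ _ lt
      (y , lt″) = ∑-< ν _ _ lt′
  in (x , y) , lt″

pushforward : ∀ {A B} → (A → B) → Measure A → Measure B
pushforward h μ .∑ f = ∑ μ (f ∘ h)
pushforward h μ .∑-+ f g = ∑-+ μ (f ∘ h) (g ∘ h)
pushforward h μ .∑-< f g lt = let (x , lt′) = ∑-< μ _ _ lt in h x , lt′

∑-⊗-* : ∀ {A B} (μ : Measure A) (ν : Measure B) h f g → (∀ x y → h (x , y) ≡ f x * g y) →
        ∑ (μ ⊗ ν) h ≡ ∑ μ f * ∑ ν g
∑-⊗-* μ ν h f g eq =
  trans (∑-cong μ λ x → trans (∑-cong ν (eq x)) (∑-*ˡ ν (f x) g)) (∑-*ʳ μ (∑ ν g) f)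

total-⊗ : ∀ {A B} (μ : Measure A) (ν : Measure B) → total (μ ⊗ ν) ≡ total μ * total ν
total-⊗ μ ν = ∑-⊗-* μ ν (λ _ → 1) (λ _ → 1) (λ _ → 1) (λ _ _ → refl)

coins : ℕ → ∀ n → Measure (Vec Bool n)
coins p zero    = dirac []
coins p (suc n) = pushforward (uncurry _∷_) (coin p ⊗ coins p n)

-- Row i of an upper triangular Boolean matrix lists the adjacencies of vertex i to the later ones.
data Triangle : ℕ → Set where
  []  : Triangle 0
  _∷_ : ∀ {n} → Vec Bool n → Triangle n → Triangle (suc n)

-- The random graph with edge probability 1 / (1 + p), unnormalised.
randomGraph : ℕ → ∀ n → Measure (Triangle n)
randomGraph p zero    = dirac []
randomGraph p (suc n) = pushforward (uncurry _∷_) (coins p n ⊗ randomGraph p n)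

edges : ∀ {n} → Subset n → Triangle n → ℕ
edges []            []      = 0
edges (inside  ∷ T) (r ∷ G) = ∣ T ∩ r ∣ + edges T G
edges (outside ∷ T) (r ∷ G) = edges T G

-- The binomial coefficient "k choose 2", the number of pairs in a k-set; the index is shifted by
-- one against the usual triangular numbers.
triangular : ℕ → ℕ
triangular zero    = 0
triangular (suc k) = k + triangular k

total-coins>0 : ∀ p n → total (coins p n) > 0
total-coins>0 p zero    = s≤s z≤n
total-coins>0 p (suc n) =
  subst (_> 0) (sym (total-⊗ (coin p) (coins p n))) (*-mono-≤ {1} {1 + p * 1} (m≤m+n 1 (p * 1)) (total-coins>0 p n))

total-randomGraph>0 : ∀ p n → total (randomGraph p n) > 0
total-randomGraph>0 p zero    = s≤s z≤n
total-randomGraph>0 p (suc n) =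
  subst (_> 0) (sym (total-⊗ (coins p n) (randomGraph p n))) (*-mono-≤ (total-coins>0 p n) (total-randomGraph>0 p n))

coins-moment : ∀ p a {n} (T : Subset n) →
  ∑ (coins p n) (λ r → a ^ ∣ T ∩ r ∣) * suc p ^ ∣ T ∣ ≡ (a + p) ^ ∣ T ∣ * total (coins p n)
coins-moment p a [] = refl
coins-moment p a {suc n} (inside ∷ T) = begin
  S * suc p ^ suc ∣ T ∣
    ≡⟨ cong (_* suc p ^ suc ∣ T ∣)
         (∑-⊗-* (coin p) (coins p n) (λ (b , r) → a ^ ∣ (inside ∷ T) ∩ (b ∷ r) ∣)
           (λ b → if b then a else 1) (λ r → a ^ ∣ T ∩ r ∣)
           λ { true r → refl ; false r → sym (*-identityˡ _) }) ⟩
  (a + p * 1) * S′ * suc p ^ suc ∣ T ∣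
    ≡⟨ eq₁ a p S′ (suc p ^ ∣ T ∣) ⟩
  (a + p) * (1 + p * 1) * (S′ * suc p ^ ∣ T ∣)
    ≡⟨ cong ((a + p) * (1 + p * 1) *_) (coins-moment p a T) ⟩
  (a + p) * (1 + p * 1) * ((a + p) ^ ∣ T ∣ * total (coins p n))
    ≡⟨ eq₂ (a + p) (1 + p * 1) ((a + p) ^ ∣ T ∣) (total (coins p n)) ⟩
  (a + p) ^ suc ∣ T ∣ * ((1 + p * 1) * total (coins p n))
    ≡⟨ cong ((a + p) ^ suc ∣ T ∣ *_) (total-⊗ (coin p) (coins p n)) ⟨
  (a + p) ^ suc ∣ T ∣ * total (coins p (suc n)) ∎
  where
  open ≡-Reasoning
  S  = ∑ (coins p (suc n)) (λ r → a ^ ∣ (inside ∷ T) ∩ r ∣)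
  S′ = ∑ (coins p n) (λ r → a ^ ∣ T ∩ r ∣)
  eq₁ : ∀ a p s x → (a + p * 1) * s * (suc p * x) ≡ (a + p) * (1 + p * 1) * (s * x)
  eq₁ = solve-∀
  eq₂ : ∀ x y z w → x * y * (z * w) ≡ x * z * (y * w)
  eq₂ = solve-∀
coins-moment p a {suc n} (outside ∷ T) = begin
  S * suc p ^ ∣ T ∣
    ≡⟨ cong (_* suc p ^ ∣ T ∣)
         (∑-⊗-* (coin p) (coins p n) (λ (b , r) → a ^ ∣ T ∩ r ∣) (λ _ → 1) (λ r → a ^ ∣ T ∩ r ∣)
           λ _ _ → sym (*-identityˡ _)) ⟩
  (1 + p * 1) * S′ * suc p ^ ∣ T ∣
    ≡⟨ *-assoc (1 + p * 1) S′ _ ⟩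
  (1 + p * 1) * (S′ * suc p ^ ∣ T ∣)
    ≡⟨ cong ((1 + p * 1) *_) (coins-moment p a T) ⟩
  (1 + p * 1) * ((a + p) ^ ∣ T ∣ * total (coins p n))
    ≡⟨ eq (1 + p * 1) ((a + p) ^ ∣ T ∣) (total (coins p n)) ⟩
  (a + p) ^ ∣ T ∣ * ((1 + p * 1) * total (coins p n))
    ≡⟨ cong ((a + p) ^ ∣ T ∣ *_) (total-⊗ (coin p) (coins p n)) ⟨
  (a + p) ^ ∣ T ∣ * total (coins p (suc n)) ∎
  where
  open ≡-Reasoning
  S  = ∑ (coins p (suc n)) (λ r → a ^ ∣ (outside ∷ T) ∩ r ∣)
  S′ = ∑ (coins p n) (λ r → a ^ ∣ T ∩ r ∣)
  eq : ∀ y z w → y * (z * w) ≡ z * (y * w)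
  eq = solve-∀

-- The generating function of the number of edges inside `T`: rows are independent, and each pair
-- contributes the factor `(a+p)/(1+p)`. It is used at `a = l`, and at `a = 0`, where `0 ^ e` is the
-- indicator of `e ≡ 0` and the moment is the probability that `T` is independent.
edges-moment : ∀ p a {n} (T : Subset n) →
  ∑ (randomGraph p n) (λ G → a ^ edges T G) * suc p ^ triangular ∣ T ∣
    ≡ (a + p) ^ triangular ∣ T ∣ * total (randomGraph p n)
edges-moment p a [] = refl
edges-moment p a {suc n} (inside ∷ T) = begin
  S * q ^ (k + triangular k)
    ≡⟨ cong₂ _*_
         (∑-⊗-* (coins p n) (randomGraph p n) (λ (r , G) → a ^ (∣ T ∩ r ∣ + edges T G))
           (λ r → a ^ ∣ T ∩ r ∣) (λ G → a ^ edges T G) λ r G → ^-distribˡ-+-* a ∣ T ∩ r ∣ (edges T G))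
         (^-distribˡ-+-* q k (triangular k)) ⟩
  R * S′ * (q ^ k * q ^ triangular k)
    ≡⟨ eq R S′ (q ^ k) (q ^ triangular k) ⟩
  R * q ^ k * (S′ * q ^ triangular k)
    ≡⟨ cong₂ _*_ (coins-moment p a T) (edges-moment p a T) ⟩
  (a + p) ^ k * total (coins p n) * ((a + p) ^ triangular k * total (randomGraph p n))
    ≡⟨ eq ((a + p) ^ k) (total (coins p n)) ((a + p) ^ triangular k) (total (randomGraph p n)) ⟩
  (a + p) ^ k * (a + p) ^ triangular k * (total (coins p n) * total (randomGraph p n))
    ≡⟨ cong₂ _*_ (^-distribˡ-+-* (a + p) k (triangular k)) (total-⊗ (coins p n) (randomGraph p n)) ⟨
  (a + p) ^ (k + triangular k) * total (randomGraph p (suc n)) ∎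
  where
  open ≡-Reasoning
  q = suc p
  k = ∣ T ∣
  S  = ∑ (randomGraph p (suc n)) (λ G → a ^ edges (inside ∷ T) G)
  S′ = ∑ (randomGraph p n) (λ G → a ^ edges T G)
  R  = ∑ (coins p n) (λ r → a ^ ∣ T ∩ r ∣)
  eq : ∀ x y z w → x * y * (z * w) ≡ x * z * (y * w)
  eq = solve-∀
edges-moment p a {suc n} (outside ∷ T) = begin
  S * q ^ triangular k
    ≡⟨ cong (_* q ^ triangular k)
         (∑-⊗-* (coins p n) (randomGraph p n) (λ (r , G) → a ^ edges T G)
           (λ _ → 1) (λ G → a ^ edges T G) λ _ _ → sym (*-identityˡ _)) ⟩
  total (coins p n) * S′ * q ^ triangular k
    ≡⟨ *-assoc (total (coins p n)) S′ _ ⟩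
  total (coins p n) * (S′ * q ^ triangular k)
    ≡⟨ cong (total (coins p n) *_) (edges-moment p a T) ⟩
  total (coins p n) * ((a + p) ^ triangular k * total (randomGraph p n))
    ≡⟨ eq (total (coins p n)) ((a + p) ^ triangular k) (total (randomGraph p n)) ⟩
  (a + p) ^ triangular k * (total (coins p n) * total (randomGraph p n))
    ≡⟨ cong ((a + p) ^ triangular k *_) (total-⊗ (coins p n) (randomGraph p n)) ⟨
  (a + p) ^ triangular k * total (randomGraph p (suc n)) ∎
  where
  open ≡-Reasoning
  q = suc p
  k = ∣ T ∣
  S  = ∑ (randomGraph p (suc n)) (λ G → a ^ edges (outside ∷ T) G)
  S′ = ∑ (randomGraph p n) (λ G → a ^ edges T G)
  eq : ∀ y z w → y * (z * w) ≡ z * (y * w)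
  eq = solve-∀

-- Sums over the subsets of a given size, and binomial coefficients

subsetSum : ∀ n (k : ℕ) → (Subset n → ℕ) → ℕ
subsetSum zero    zero    f = f []
subsetSum zero    (suc k) f = 0
subsetSum (suc n) zero    f = subsetSum n zero (f ∘ (outside ∷_))
subsetSum (suc n) (suc k) f = subsetSum n k (f ∘ (inside ∷_)) + subsetSum n (suc k) (f ∘ (outside ∷_))

-- As a sum of ones it fits termwise bounds such as `subsetSum-≤`, and Pascal's rule holds by
-- computation.
binom : ℕ → ℕ → ℕ
binom n k = subsetSum n k λ _ → 1

term≤subsetSum : ∀ {n} (f : Subset n → ℕ) T → f T ≤ subsetSum n ∣ T ∣ f
term≤subsetSum f [] = ≤-refl
term≤subsetSum f (inside ∷ T) = ≤-trans (term≤subsetSum (f ∘ (inside ∷_)) T) (m≤m+n _ _)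
term≤subsetSum f (outside ∷ T) with ∣ T ∣ | term≤subsetSum (f ∘ (outside ∷_)) T
... | zero  | le = le
... | suc k | le = ≤-trans le (m≤n+m _ _)

subsetSum-≤ : ∀ n k (f : Subset n → ℕ) {c d} → (∀ T → ∣ T ∣ ≡ k → f T * d ≤ c) →
  subsetSum n k f * d ≤ binom n k * c
subsetSum-≤ zero zero f {c} h = ≤-trans (h [] refl) (≤-reflexive (sym (*-identityˡ c)))
subsetSum-≤ zero (suc k) f h = z≤n
subsetSum-≤ (suc n) zero f h = subsetSum-≤ n zero (f ∘ (outside ∷_)) λ T → h (outside ∷ T)
subsetSum-≤ (suc n) (suc k) f {c} {d} h = begin
  (subsetSum n k (f ∘ (inside ∷_)) + subsetSum n (suc k) (f ∘ (outside ∷_))) * d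
    ≡⟨ *-distribʳ-+ d (subsetSum n k (f ∘ (inside ∷_))) _ ⟩
  subsetSum n k (f ∘ (inside ∷_)) * d + subsetSum n (suc k) (f ∘ (outside ∷_)) * d
    ≤⟨ +-mono-≤ (subsetSum-≤ n k (f ∘ (inside ∷_)) λ T eq → h (inside ∷ T) (cong suc eq))
                (subsetSum-≤ n (suc k) (f ∘ (outside ∷_)) λ T → h (outside ∷ T)) ⟩
  binom n k * c + binom n (suc k) * c
    ≡⟨ *-distribʳ-+ c (binom n k) _ ⟨
  binom (suc n) (suc k) * c ∎
  where open ≤-Reasoning

∑-subsetSum : ∀ {A} (μ : Measure A) n (k : ℕ) (f : Subset n → A → ℕ) →
  ∑ μ (λ x → subsetSum n k λ T → f T x) ≡ subsetSum n k λ T → ∑ μ (f T)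
∑-subsetSum μ zero zero f = refl
∑-subsetSum μ zero (suc k) f = ∑-0 μ
∑-subsetSum μ (suc n) zero f = ∑-subsetSum μ n zero (f ∘ (outside ∷_))
∑-subsetSum μ (suc n) (suc k) f =
  trans (∑-+ μ _ _) (cong₂ _+_ (∑-subsetSum μ n k (f ∘ (inside ∷_))) (∑-subsetSum μ n (suc k) (f ∘ (outside ∷_))))

∑-subsetSum-edges-≤ : ∀ p a n k →
  ∑ (randomGraph p n) (λ G → subsetSum n k λ T → a ^ edges T G) * suc p ^ triangular k
    ≤ binom n k * ((a + p) ^ triangular k * total (randomGraph p n))
∑-subsetSum-edges-≤ p a n k = begin
  ∑ (randomGraph p n) (λ G → subsetSum n k λ T → a ^ edges T G) * suc p ^ triangular k
    ≡⟨ cong (_* suc p ^ triangular k) (∑-subsetSum (randomGraph p n) n k λ T G → a ^ edges T G) ⟩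
  subsetSum n k (λ T → ∑ (randomGraph p n) λ G → a ^ edges T G) * suc p ^ triangular k
    ≤⟨ subsetSum-≤ n k _ (λ { T refl → ≤-reflexive (edges-moment p a T) }) ⟩
  binom n k * ((a + p) ^ triangular k * total (randomGraph p n)) ∎
  where open ≤-Reasoning

-- Pascal's rule on the left is matched by `bernoulli` on the right, so falling factorials do not
-- appear.
binom*!≤^ : ∀ n k → binom n k * k ! ≤ n ^ k
binom*!≤^ zero    zero    = ≤-refl
binom*!≤^ zero    (suc k) = z≤n
binom*!≤^ (suc n) zero    = binom*!≤^ n zero
binom*!≤^ (suc n) (suc k) = begin
  (binom n k + binom n (suc k)) * (suc k * k !)
    ≡⟨ eq (binom n k) (binom n (suc k)) (suc k) (k !) ⟩
  binom n (suc k) * (suc k * k !) + suc k * (binom n k * k !)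
    ≤⟨ +-mono-≤ (binom*!≤^ n (suc k)) (*-monoʳ-≤ (suc k) (binom*!≤^ n k)) ⟩
  n ^ suc k + suc k * n ^ k
    ≤⟨ bernoulli n k ⟩
  suc n ^ suc k ∎
  where
  open ≤-Reasoning
  eq : ∀ x y k z → (x + y) * (k * z) ≡ y * (k * z) + k * (x * z)
  eq = solve-∀

-- The familiar bound `(en/k)^k` with 4 in place of `e`.
binom*^≤ : ∀ n k → binom n k * k ^ k ≤ (4 * n) ^ k
binom*^≤ n k = begin
  binom n k * k ^ k           ≤⟨ *-monoʳ-≤ (binom n k) (^≤4^*! k k) ⟩
  binom n k * (4 ^ k * k !)   ≡⟨ eq (binom n k) (4 ^ k) (k !) ⟩
  4 ^ k * (binom n k * k !)   ≤⟨ *-monoʳ-≤ (4 ^ k) (binom*!≤^ n k) ⟩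
  4 ^ k * n ^ k               ≡⟨ ^-distribʳ-* 4 n k ⟨
  (4 * n) ^ k ∎
  where
  open ≤-Reasoning
  eq : ∀ x y z → x * (y * z) ≡ y * (x * z)
  eq = solve-∀

-- Turán's theorem by greedy colouring

data Adjacent : ∀ {n} → Triangle n → Fin n → Fin n → Set where
  right : ∀ {n r} {G : Triangle n} {j} → j ∈ r → Adjacent (r ∷ G) zero (suc j)
  left  : ∀ {n r} {G : Triangle n} {j} → j ∈ r → Adjacent (r ∷ G) (suc j) zero
  later : ∀ {n r} {G : Triangle n} {i j} → Adjacent G i j → Adjacent (r ∷ G) (suc i) (suc j)

graph : ∀ {n} → Triangle n → Graph n
graph G = record { Adj = Adjacent G ; sym = symmetric ; irrefl = irreflexive }
  where
  symmetric : ∀ {n} {G : Triangle n} {i j} → Adjacent G i j → Adjacent G j i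
  symmetric (right j∈r) = left j∈r
  symmetric (left j∈r)  = right j∈r
  symmetric (later a)   = later (symmetric a)
  irreflexive : ∀ {n} {G : Triangle n} {i} → ¬ Adjacent G i i
  irreflexive (later a) = irreflexive a

edges-⊥ : ∀ {n} (G : Triangle n) → edges ⊥ G ≡ 0
edges-⊥ []      = refl
edges-⊥ (r ∷ G) = edges-⊥ G

∣∩∣≡0⇒disjoint : ∀ {n} (T r : Subset n) {j} → ∣ T ∩ r ∣ ≡ 0 → j ∈ T → ¬ j ∈ r
∣∩∣≡0⇒disjoint (inside ∷ T) (outside ∷ r) eq (there j∈T) (there j∈r) = ∣∩∣≡0⇒disjoint T r eq j∈T j∈r
∣∩∣≡0⇒disjoint (outside ∷ T) (b ∷ r)      eq (there j∈T) (there j∈r) = ∣∩∣≡0⇒disjoint T r eq j∈T j∈r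

disjoint⇒∣∩∣≡0 : ∀ {n} (T r : Subset n) → (∀ j → j ∈ T → ¬ j ∈ r) → ∣ T ∩ r ∣ ≡ 0
disjoint⇒∣∩∣≡0 []            []            dis = refl
disjoint⇒∣∩∣≡0 (inside ∷ T)  (inside ∷ r)  dis = contradiction here (dis zero here)
disjoint⇒∣∩∣≡0 (inside ∷ T)  (outside ∷ r) dis = disjoint⇒∣∩∣≡0 T r λ j a b → dis (suc j) (there a) (there b)
disjoint⇒∣∩∣≡0 (outside ∷ T) (b ∷ r)       dis = disjoint⇒∣∩∣≡0 T r λ j a b → dis (suc j) (there a) (there b)

edges≡0⇒independent : ∀ {n} (T : Subset n) (G : Triangle n) → edges T G ≡ 0 → Independent (graph G) T
edges≡0⇒independent (inside ∷ T) (r ∷ G) e≡0 _ _ here (there v∈T) (right v∈r) =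
  ∣∩∣≡0⇒disjoint T r (m+n≡0⇒m≡0 ∣ T ∩ r ∣ e≡0) v∈T v∈r
edges≡0⇒independent (inside ∷ T) (r ∷ G) e≡0 _ _ (there u∈T) here (left u∈r) =
  ∣∩∣≡0⇒disjoint T r (m+n≡0⇒m≡0 ∣ T ∩ r ∣ e≡0) u∈T u∈r
edges≡0⇒independent (inside ∷ T) (r ∷ G) e≡0 _ _ (there u∈T) (there v∈T) (later a) =
  edges≡0⇒independent T G (m+n≡0⇒n≡0 ∣ T ∩ r ∣ e≡0) _ _ u∈T v∈T a
edges≡0⇒independent (outside ∷ T) (r ∷ G) e≡0 _ _ (there u∈T) (there v∈T) (later a) =
  edges≡0⇒independent T G e≡0 _ _ u∈T v∈T a

independent⇒edges≡0 : ∀ {n} (T : Subset n) (G : Triangle n) → Independent (graph G) T → edges T G ≡ 0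
independent⇒edges≡0 [] [] ind = refl
independent⇒edges≡0 (inside ∷ T) (r ∷ G) ind =
  cong₂ _+_ (disjoint⇒∣∩∣≡0 T r λ j j∈T j∈r → ind zero (suc j) here (there j∈T) (right j∈r))
            (independent⇒edges≡0 T G λ u v u∈T v∈T a → ind (suc u) (suc v) (there u∈T) (there v∈T) (later a))
independent⇒edges≡0 (outside ∷ T) (r ∷ G) ind =
  independent⇒edges≡0 T G λ u v u∈T v∈T a → ind (suc u) (suc v) (there u∈T) (there v∈T) (later a)

independent-⊆ : ∀ {n} {G : Graph n} {I J} → I ⊆ J → Independent G J → Independent G I
independent-⊆ I⊆J ind u v u∈I v∈I = ind u v (I⊆J u∈I) (I⊆J v∈I)

subset-of-size : ∀ {n} (T : Subset n) k → k ≤ ∣ T ∣ → ∃ λ I → I ⊆ T × ∣ I ∣ ≡ k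
subset-of-size {n} T zero _ = ⊥ , ⊥⊆ , ∣⊥∣≡0 n
subset-of-size (inside ∷ T) (suc k) (s≤s k≤) =
  let (I , I⊆T , eq) = subset-of-size T k k≤ in inside ∷ I , s⊆s I⊆T , cong suc eq
subset-of-size (outside ∷ T) (suc k) k≤ =
  let (I , I⊆T , eq) = subset-of-size T (suc k) k≤ in outside ∷ I , s⊆s I⊆T , eq

meets : ∀ {n} → Subset n → List (Subset n) → ℕ
meets r Ls = sum (map (λ L → ∣ L ∩ r ∣) Ls)

sizes : ∀ {n} → List (Subset n) → ℕ
sizes Ls = sum (map ∣_∣ Ls)

-- The number of (vertex, earlier level) pairs; greedy colouring charges each of them to its own edge.
cost : ∀ {n} → List (Subset n) → ℕ
cost []       = 0
cost (L ∷ Ls) = sizes Ls + cost Ls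

-- First fit: the new vertex 0 joins the first level without a neighbour of it. Vertices arrive from
-- last to first, because the row `r` of a vertex lists its later neighbours, which are already
-- placed.
insert : ∀ {n} → Subset n → List (Subset n) → List (Subset (suc n))
insert r []       = (inside ∷ ⊥) ∷ []
insert r (L ∷ Ls) with ∣ L ∩ r ∣ ≟ 0
... | yes _ = (inside ∷ L) ∷ map (outside ∷_) Ls
... | no  _ = (outside ∷ L) ∷ insert r Ls

sizes-outside : ∀ {n} (Ls : List (Subset n)) → sizes (map (outside ∷_) Ls) ≡ sizes Ls
sizes-outside []       = refl
sizes-outside (L ∷ Ls) = cong (∣ L ∣ +_) (sizes-outside Ls)

cost-outside : ∀ {n} (Ls : List (Subset n)) → cost (map (outside ∷_) Ls) ≡ cost Ls
cost-outside []       = refl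
cost-outside (L ∷ Ls) = cong₂ _+_ (sizes-outside Ls) (cost-outside Ls)

meets-outside : ∀ {n} b r (Ls : List (Subset n)) → meets (b ∷ r) (map (outside ∷_) Ls) ≡ meets r Ls
meets-outside b r []       = refl
meets-outside b r (L ∷ Ls) = cong (∣ L ∩ r ∣ +_) (meets-outside b r Ls)

sizes-insert : ∀ {n} r (Ls : List (Subset n)) → sizes (insert r Ls) ≡ suc (sizes Ls)
sizes-insert {n} r [] = cong suc (trans (+-identityʳ _) (∣⊥∣≡0 n))
sizes-insert r (L ∷ Ls) with ∣ L ∩ r ∣ ≟ 0
... | yes _ = cong (λ x → suc (∣ L ∣ + x)) (sizes-outside Ls)
... | no  _ = trans (cong (∣ L ∣ +_) (sizes-insert r Ls)) (+-suc ∣ L ∣ (sizes Ls))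

meets-insert : ∀ {n} r b r′ (Ls : List (Subset n)) →
  meets (b ∷ r′) (insert r Ls) ≡ ∣ (inside ∷ ⊥) ∩ (b ∷ r′) ∣ + meets r′ Ls
meets-insert r b r′ [] = refl
meets-insert {n} r b r′ (L ∷ Ls) with ∣ L ∩ r ∣ ≟ 0
... | no _ = trans (cong (∣ L ∩ r′ ∣ +_) (meets-insert r b r′ Ls))
                   (eq ∣ L ∩ r′ ∣ ∣ (inside ∷ ⊥) ∩ (b ∷ r′) ∣ (meets r′ Ls))
  where
  eq : ∀ x y z → x + (y + z) ≡ y + (x + z)
  eq = solve-∀
meets-insert {n} r inside r′ (L ∷ Ls) | yes _
  rewrite meets-outside inside r′ Ls | ∩-zeroˡ r′ | ∣⊥∣≡0 n = refl
meets-insert {n} r outside r′ (L ∷ Ls) | yes _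
  rewrite meets-outside outside r′ Ls | ∩-zeroˡ r′ | ∣⊥∣≡0 n = refl

-- The cost grows by the number of levels skipped, and every skipped level contains at least one
-- neighbour.
cost-insert : ∀ {n} r (Ls : List (Subset n)) → cost (insert r Ls) ≤ meets r Ls + cost Ls
cost-insert r [] = z≤n
cost-insert r (L ∷ Ls) with ∣ L ∩ r ∣ ≟ 0
... | yes _ = begin
  sizes (map (outside ∷_) Ls) + cost (map (outside ∷_) Ls)
    ≡⟨ cong₂ _+_ (sizes-outside Ls) (cost-outside Ls) ⟩
  cost (L ∷ Ls)                       ≤⟨ m≤n+m _ (meets r (L ∷ Ls)) ⟩
  meets r (L ∷ Ls) + cost (L ∷ Ls) ∎
  where open ≤-Reasoning
... | no ≢0 = begin
  sizes (insert r Ls) + cost (insert r Ls)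
    ≤⟨ +-mono-≤ (≤-reflexive (sizes-insert r Ls)) (cost-insert r Ls) ⟩
  1 + sizes Ls + (meets r Ls + cost Ls)
    ≤⟨ +-monoˡ-≤ _ (+-monoˡ-≤ (sizes Ls) (n≢0⇒n>0 ≢0)) ⟩
  ∣ L ∩ r ∣ + sizes Ls + (meets r Ls + cost Ls)
    ≡⟨ eq ∣ L ∩ r ∣ (sizes Ls) (meets r Ls) (cost Ls) ⟩
  meets r (L ∷ Ls) + cost (L ∷ Ls) ∎
  where
  open ≤-Reasoning
  eq : ∀ a b c d → a + b + (c + d) ≡ a + c + (b + d)
  eq = solve-∀

Level : ∀ {n} → Subset n → Triangle n → Subset n → Set
Level T G L = L ⊆ T × edges L G ≡ 0

level-outside : ∀ {n} r {b} {T : Subset n} {G L} → Level T G L → Level (b ∷ T) (r ∷ G) (outside ∷ L)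
level-outside r (L⊆T , e≡0) = out⊆ L⊆T , e≡0

insert-levels : ∀ {n} {T r : Subset n} {G} {Ls} → All (Level T G) Ls → All (Level (inside ∷ T) (r ∷ G)) (insert r Ls)
insert-levels {n} {r = r} {G} [] =
  (in⊆in ⊥⊆ , cong₂ _+_ (trans (cong ∣_∣ (∩-zeroˡ r)) (∣⊥∣≡0 n)) (edges-⊥ G)) ∷ []
insert-levels {r = r} {Ls = L ∷ Ls} ((L⊆T , e≡0) ∷ levels) with ∣ L ∩ r ∣ ≟ 0
... | yes ≡0 = (in⊆in L⊆T , cong₂ _+_ ≡0 e≡0) ∷ gmap⁺ (λ {L} → level-outside r {L = L}) levels
... | no  _  = (out⊆ L⊆T , e≡0) ∷ insert-levels levels

-- `meets-levels` expresses that the classes partition `T`, by counting against an arbitrary set. At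
-- the row of a new vertex it counts the edges from that vertex into `T`; at `⊤` it gives the total
-- size.
record GreedyColouring {n} (T : Subset n) (G : Triangle n) : Set where
  field
    classes      : List (Subset n)
    levels       : All (Level T G) classes
    cost≤edges   : cost classes ≤ edges T G
    meets-levels : ∀ r → meets r classes ≡ ∣ T ∩ r ∣

open GreedyColouring

greedy : ∀ {n} (T : Subset n) G → GreedyColouring T G
greedy [] [] = record { classes = [] ; levels = [] ; cost≤edges = z≤n ; meets-levels = λ { [] → refl } }
greedy {suc n} (inside ∷ T) (r ∷ G) = record
  { classes      = insert r (classes c)
  ; levels       = insert-levels (levels c)
  ; cost≤edges   = ≤-trans (cost-insert r (classes c))
                     (+-mono-≤ (≤-reflexive (meets-levels c r)) (cost≤edges c))
  ; meets-levels = λ { (b ∷ r′) → trans (meets-insert r b r′ (classes c)) (meet b r′) }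
  }
  where
  c = greedy T G
  meet : ∀ b r′ → ∣ (inside ∷ ⊥) ∩ (b ∷ r′) ∣ + meets r′ (classes c) ≡ ∣ (inside ∷ T) ∩ (b ∷ r′) ∣
  meet inside  r′ rewrite ∩-zeroˡ r′ | ∣⊥∣≡0 n = cong suc (meets-levels c r′)
  meet outside r′ rewrite ∩-zeroˡ r′ | ∣⊥∣≡0 n = meets-levels c r′
greedy (outside ∷ T) (r ∷ G) = record
  { classes      = map (outside ∷_) (classes c)
  ; levels       = gmap⁺ (λ {L} → level-outside r {L = L}) (levels c)
  ; cost≤edges   = ≤-trans (≤-reflexive (cost-outside (classes c))) (cost≤edges c)
  ; meets-levels = λ { (b ∷ r′) → trans (meets-outside b r′ (classes c)) (meets-levels c r′) }
  }
  where c = greedy T G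

meets-⊤ : ∀ {n} (Ls : List (Subset n)) → meets ⊤ Ls ≡ sizes Ls
meets-⊤ []       = refl
meets-⊤ (L ∷ Ls) = cong₂ _+_ (cong ∣_∣ (∩-identityʳ L)) (meets-⊤ Ls)

-- Expand the square level by level: the diagonal term `x x` is at most `x t`, the cross term
-- `2 W x` with the later levels is at most `2 t W`, and these `W` add up to the cost.
sizes²≤ : ∀ {n} t (Ls : List (Subset n)) → All (λ L → ∣ L ∣ ≤ t) Ls →
  sizes Ls * sizes Ls ≤ 2 * t * cost Ls + sizes Ls * t
sizes²≤ t [] [] = z≤n
sizes²≤ t (L ∷ Ls) (x≤t ∷ small) = begin
  (x + W) * (x + W)                                 ≡⟨ eq₁ x W ⟩
  W * W + (2 * W * x + x * x)                       ≤⟨ +-mono-≤ (sizes²≤ t Ls small)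
                                                        (+-mono-≤ (*-monoʳ-≤ (2 * W) x≤t) (*-monoʳ-≤ x x≤t)) ⟩
  2 * t * cost Ls + W * t + (2 * W * t + x * t)     ≡⟨ eq₂ t (cost Ls) W x ⟩
  2 * t * (W + cost Ls) + (x + W) * t ∎
  where
  open ≤-Reasoning
  x = ∣ L ∣
  W = sizes Ls
  eq₁ : ∀ x W → (x + W) * (x + W) ≡ W * W + (2 * W * x + x * x)
  eq₁ = solve-∀
  eq₂ : ∀ t c W x → 2 * t * c + W * t + (2 * W * t + x * t) ≡ 2 * t * (W + c) + (x + W) * t
  eq₂ = solve-∀

-- A level with at least `t` vertices contains the independent set. If there is none, the vertices
-- are spread over many small levels, so the cost is large, and it is a lower bound for the number
-- of edges.
turán : ∀ {n} t (T : Subset n) G →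
  (∃ λ I → I ⊆ T × Independent (graph G) I × ∣ I ∣ ≡ t) ⊎ ∣ T ∣ * ∣ T ∣ ≤ 2 * t * edges T G + ∣ T ∣ * t
turán t T G with any? (λ L → t ≤? ∣ L ∣) (classes (greedy T G))
... | yes large =
  let ((L⊆T , e≡0) , t≤∣L∣) = All.lookupAny (levels (greedy T G)) large
      (I , I⊆L , ∣I∣≡t) = subset-of-size _ t t≤∣L∣
  in inj₁ (I , ⊆-trans I⊆L L⊆T , independent-⊆ {G = graph G} I⊆L (edges≡0⇒independent _ G e≡0) , ∣I∣≡t)
... | no ¬large = inj₂ (begin
  ∣ T ∣ * ∣ T ∣                     ≡⟨ cong₂ _*_ size size ⟨
  W * W                             ≤⟨ sizes²≤ t (classes c) (All.map ≰⇒≥ (¬Any⇒All¬ (classes c) ¬large)) ⟩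
  2 * t * cost (classes c) + W * t
    ≤⟨ +-mono-≤ (*-monoʳ-≤ (2 * t) (cost≤edges c)) (≤-reflexive (cong (_* t) size)) ⟩
  2 * t * edges T G + ∣ T ∣ * t ∎)
  where
  open ≤-Reasoning
  c = greedy T G
  W = sizes (classes c)
  size : W ≡ ∣ T ∣
  size = trans (sym (meets-⊤ (classes c))) (trans (meets-levels c ⊤) (cong ∣_∣ (∩-identityʳ T)))

no-edgeless-k-set : ∀ {n} k (G : Triangle n) → subsetSum n k (λ T → 0 ^ edges T G) ≡ 0 →
  ∀ I → Independent (graph G) I → ∣ I ∣ < k
no-edgeless-k-set {n} k G none I ind with k ≤? ∣ I ∣
... | no k≰  = ≰⇒> k≰
... | yes k≤ with subset-of-size I k k≤
...   | J , J⊆I , refl = contradiction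
  (≤-trans (≤-reflexive (sym (cong (0 ^_) (independent⇒edges≡0 J G (independent-⊆ {G = graph G} J⊆I ind)))))
           (≤-trans (term≤subsetSum (λ T → 0 ^ edges T G) J) (≤-reflexive none)))
  λ ()

-- If `S` had no independent t-subset, `turán` and `dense` would give it at least `m` edges, and its
-- single term would already reach `a ^ m`.
few-edges⇒independent : ∀ {n} s t a m (G : Triangle n) .{{_ : NonZero a}} →
  (∀ e → s * s ≤ 2 * t * e + s * t → m ≤ e) →
  subsetSum n s (λ T → a ^ edges T G) < a ^ m → EverySSetHasIndepT (graph G) s t
few-edges⇒independent s t a m G dense few S refl with turán t S G
... | inj₁ found = found
... | inj₂ many  = contradiction few
  (≤⇒≯ (≤-trans (^-monoʳ-≤ a (dense _ many)) (term≤subsetSum (λ T → a ^ edges T G) S)))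

-- Rational bounds for the power and the logarithm

⟦⟧-≃ : ∀ k → toℚᵘ ⟦ k ⟧ ℚᵘ.≃ mkℚᵘ (ℤ.+ k) 0
⟦⟧-≃ k = ℚ.toℚᵘ-fromℚᵘ (mkℚᵘ (ℤ.+ k) 0)

⟦⟧-+ : ∀ m n → ⟦ m + n ⟧ ≡ ⟦ m ⟧ ℚ.+ ⟦ n ⟧
⟦⟧-+ m n = ℚ.toℚᵘ-injective (begin
  toℚᵘ ⟦ m + n ⟧                      ≈⟨ ⟦⟧-≃ (m + n) ⟩
  mkℚᵘ (ℤ.+ (m + n)) 0                ≈⟨ *≡* (cong (ℤ._* ℤ.+ 1)
                                           (cong₂ ℤ._+_ (sym (ℤ.*-identityʳ (ℤ.+ m))) (sym (ℤ.*-identityʳ (ℤ.+ n))))) ⟩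
  mkℚᵘ (ℤ.+ m) 0 ℚᵘ.+ mkℚᵘ (ℤ.+ n) 0  ≈⟨ ℚᵘ.+-cong (⟦⟧-≃ m) (⟦⟧-≃ n) ⟨
  toℚᵘ ⟦ m ⟧ ℚᵘ.+ toℚᵘ ⟦ n ⟧          ≈⟨ ℚ.toℚᵘ-homo-+ ⟦ m ⟧ ⟦ n ⟧ ⟨
  toℚᵘ (⟦ m ⟧ ℚ.+ ⟦ n ⟧) ∎)
  where open ℚᵘ.≃-Reasoning

⟦⟧-* : ∀ m n → ⟦ m * n ⟧ ≡ ⟦ m ⟧ ℚ.* ⟦ n ⟧
⟦⟧-* m n = ℚ.toℚᵘ-injective (begin
  toℚᵘ ⟦ m * n ⟧                      ≈⟨ ⟦⟧-≃ (m * n) ⟩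
  mkℚᵘ (ℤ.+ (m * n)) 0                ≈⟨ *≡* (cong (ℤ._* ℤ.+ 1) (ℤ.pos-* m n)) ⟩
  mkℚᵘ (ℤ.+ m) 0 ℚᵘ.* mkℚᵘ (ℤ.+ n) 0  ≈⟨ ℚᵘ.*-cong (⟦⟧-≃ m) (⟦⟧-≃ n) ⟨
  toℚᵘ ⟦ m ⟧ ℚᵘ.* toℚᵘ ⟦ n ⟧          ≈⟨ ℚ.toℚᵘ-homo-* ⟦ m ⟧ ⟦ n ⟧ ⟨
  toℚᵘ (⟦ m ⟧ ℚ.* ⟦ n ⟧) ∎)
  where open ℚᵘ.≃-Reasoning

⟦⟧-^ : ∀ m k → ⟦ m ^ k ⟧ ≡ ⟦ m ⟧ ^ℚ k
⟦⟧-^ m zero    = refl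
⟦⟧-^ m (suc k) = trans (⟦⟧-* m (m ^ k)) (cong (⟦ m ⟧ ℚ.*_) (⟦⟧-^ m k))

⟦⟧-mono-≤ : ∀ {m n} → m ≤ n → ⟦ m ⟧ ℚ.≤ ⟦ n ⟧
⟦⟧-mono-≤ {m} {n} m≤n = ℚ.toℚᵘ-cancel-≤ (begin
  toℚᵘ ⟦ m ⟧      ≃⟨ ⟦⟧-≃ m ⟩
  mkℚᵘ (ℤ.+ m) 0  ≤⟨ *≤* (ℤ.*-monoʳ-≤-nonNeg (ℤ.+ 1) (ℤ.+≤+ m≤n)) ⟩
  mkℚᵘ (ℤ.+ n) 0  ≃⟨ ⟦⟧-≃ n ⟨
  toℚᵘ ⟦ n ⟧ ∎)
  where open ℚᵘ.≤-Reasoning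

⟦⟧-mono-< : ∀ {m n} → m < n → ⟦ m ⟧ ℚ.< ⟦ n ⟧
⟦⟧-mono-< {m} {n} m<n = ℚ.toℚᵘ-cancel-< (begin-strict
  toℚᵘ ⟦ m ⟧      ≃⟨ ⟦⟧-≃ m ⟩
  mkℚᵘ (ℤ.+ m) 0  <⟨ *<* (ℤ.*-monoʳ-<-pos (ℤ.+ 1) (ℤ.+<+ m<n)) ⟩
  mkℚᵘ (ℤ.+ n) 0  ≃⟨ ⟦⟧-≃ n ⟨
  toℚᵘ ⟦ n ⟧ ∎)
  where open ℚᵘ.≤-Reasoning

⟦⟧-cancel-≤ : ∀ {m n} → ⟦ m ⟧ ℚ.≤ ⟦ n ⟧ → m ≤ n
⟦⟧-cancel-≤ le = ≮⇒≥ λ n<m → ℚ.<-irrefl refl (ℚ.<-≤-trans (⟦⟧-mono-< n<m) le)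

⟦⟧-cancel-< : ∀ {m n} → ⟦ m ⟧ ℚ.< ⟦ n ⟧ → m < n
⟦⟧-cancel-< lt = ≰⇒> λ n≤m → ℚ.<-irrefl refl (ℚ.<-≤-trans lt (⟦⟧-mono-≤ n≤m))

0≤⟦_⟧ : ∀ k → 0ℚ ℚ.≤ ⟦ k ⟧
0≤⟦ k ⟧ = ⟦⟧-mono-≤ {0} {k} z≤n

1/suc*⟦suc⟧ : ∀ k → (ℤ.+ 1 ℚ./ suc k) ℚ.* ⟦ suc k ⟧ ≡ 1ℚ
1/suc*⟦suc⟧ k = ℚ.toℚᵘ-injective (begin
  toℚᵘ ((ℤ.+ 1 ℚ./ suc k) ℚ.* ⟦ suc k ⟧)
    ≈⟨ ℚ.toℚᵘ-homo-* (ℤ.+ 1 ℚ./ suc k) ⟦ suc k ⟧ ⟩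
  toℚᵘ (ℤ.+ 1 ℚ./ suc k) ℚᵘ.* toℚᵘ ⟦ suc k ⟧
    ≈⟨ ℚᵘ.*-cong (ℚ.toℚᵘ-fromℚᵘ (mkℚᵘ (ℤ.+ 1) k)) (⟦⟧-≃ (suc k)) ⟩
  mkℚᵘ (ℤ.+ 1) k ℚᵘ.* mkℚᵘ (ℤ.+ suc k) 0
    ≈⟨ *≡* (cong ℤ.+_ (eq k)) ⟩
  toℚᵘ 1ℚ ∎)
  where
  open ℚᵘ.≃-Reasoning
  eq : ∀ k → (suc k + 0) * 1 ≡ suc k * 1 + 0
  eq = solve-∀

archimedean : ∀ x → ∃ λ m → x ℚ.≤ ⟦ m ⟧
archimedean x@(mkℚ p d _) = ℤ.∣ p ∣ , ℚ.toℚᵘ-cancel-≤ (begin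
  mkℚᵘ p d               ≤⟨ *≤* (ℤ.≤-trans (ℤ.≤-reflexive (ℤ.*-identityʳ p)) (p≤ p)) ⟩
  mkℚᵘ (ℤ.+ ℤ.∣ p ∣) 0   ≃⟨ ⟦⟧-≃ ℤ.∣ p ∣ ⟨
  toℚᵘ ⟦ ℤ.∣ p ∣ ⟧ ∎)
  where
  open ℚᵘ.≤-Reasoning
  p≤ : ∀ p → p ℤ.≤ ℤ.+ ℤ.∣ p ∣ ℤ.* ℤ.+ suc d
  p≤ (ℤ.+ n)      = ℤ.≤-trans (ℤ.+≤+ (m≤m*n n (suc d))) (ℤ.≤-reflexive (ℤ.pos-* n (suc d)))
  p≤ (ℤ.-[1+ n ]) = ℤ.-≤+

*-monoˡ-≤ℚ : ∀ {a b} c → 0ℚ ℚ.≤ c → a ℚ.≤ b → a ℚ.* c ℚ.≤ b ℚ.* c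
*-monoˡ-≤ℚ c 0≤c = ℚ.*-monoʳ-≤-nonNeg c {{ℚ.nonNegative 0≤c}}

*-monoʳ-≤ℚ : ∀ {a b} c → 0ℚ ℚ.≤ c → a ℚ.≤ b → c ℚ.* a ℚ.≤ c ℚ.* b
*-monoʳ-≤ℚ c 0≤c = ℚ.*-monoˡ-≤-nonNeg c {{ℚ.nonNegative 0≤c}}

*-mono-≤ℚ : ∀ {a b c d} → 0ℚ ℚ.≤ a → 0ℚ ℚ.≤ d → a ℚ.≤ b → c ℚ.≤ d → a ℚ.* c ℚ.≤ b ℚ.* d
*-mono-≤ℚ {a} {b} {c} {d} 0≤a 0≤d a≤b c≤d = ℚ.≤-trans (*-monoʳ-≤ℚ a 0≤a c≤d) (*-monoˡ-≤ℚ d 0≤d a≤b)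

0≤* : ∀ {a b} → 0ℚ ℚ.≤ a → 0ℚ ℚ.≤ b → 0ℚ ℚ.≤ a ℚ.* b
0≤* {a} {b} 0≤a 0≤b = ℚ.≤-trans (ℚ.≤-reflexive (sym (ℚ.*-zeroˡ b))) (*-monoˡ-≤ℚ b 0≤b 0≤a)

*-cancelʳ-≤ℚ : ∀ {a b} k .{{_ : NonZero k}} → a ℚ.* ⟦ k ⟧ ℚ.≤ b ℚ.* ⟦ k ⟧ → a ℚ.≤ b
*-cancelʳ-≤ℚ k = ℚ.*-cancelʳ-≤-pos ⟦ k ⟧ {{ℚ.positive (⟦⟧-mono-< (>-nonZero⁻¹ k))}}

0≤^ℚ : ∀ {x} k → 0ℚ ℚ.≤ x → 0ℚ ℚ.≤ x ^ℚ k
0≤^ℚ zero    _   = 0≤⟦ 1 ⟧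
0≤^ℚ (suc k) 0≤x = 0≤* 0≤x (0≤^ℚ k 0≤x)

^ℚ-mono-≤ : ∀ {x y} k → 0ℚ ℚ.≤ x → x ℚ.≤ y → x ^ℚ k ℚ.≤ y ^ℚ k
^ℚ-mono-≤ zero    0≤x x≤y = ℚ.≤-refl
^ℚ-mono-≤ (suc k) 0≤x x≤y = *-mono-≤ℚ 0≤x (0≤^ℚ k (ℚ.≤-trans 0≤x x≤y)) x≤y (^ℚ-mono-≤ k 0≤x x≤y)

^ℚ-distrib-* : ∀ x y k → (x ℚ.* y) ^ℚ k ≡ (x ^ℚ k) ℚ.* (y ^ℚ k)
^ℚ-distrib-* x y zero    = refl
^ℚ-distrib-* x y (suc k) = trans (cong ((x ℚ.* y) ℚ.*_) (^ℚ-distrib-* x y k))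
  (solve 4 (λ a b c d → (a :* b) :* (c :* d) := (a :* c) :* (b :* d)) refl x y (x ^ℚ k) (y ^ℚ k))

0≤expTerm : ∀ k {x} → 0ℚ ℚ.≤ x → 0ℚ ℚ.≤ expTerm k x
0≤expTerm zero    0≤x = 0≤⟦ 1 ⟧
0≤expTerm (suc k) 0≤x = 0≤* (0≤* (0≤expTerm k 0≤x) 0≤x)
  (ℚ.nonNegative⁻¹ _ {{ℚ.normalize-nonNeg 1 (suc k)}})

-- The left side is `(2x)^k`, since `expTerm k x` is `x^k / k!`.
expTerm*2^*!≤ : ∀ k {x c} → 0ℚ ℚ.≤ x → x ℚ.* ⟦ 2 ⟧ ℚ.≤ ⟦ c ⟧ →
  expTerm k x ℚ.* ⟦ 2 ^ k ⟧ ℚ.* ⟦ k ! ⟧ ℚ.≤ ⟦ c ^ k ⟧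
expTerm*2^*!≤ zero    0≤x 2x≤c = ℚ.≤-refl
expTerm*2^*!≤ (suc k) {x} {c} 0≤x 2x≤c = begin
  E ℚ.* x ℚ.* i ℚ.* ⟦ 2 ^ suc k ⟧ ℚ.* ⟦ suc k ! ⟧
    ≡⟨ cong₂ (λ a b → E ℚ.* x ℚ.* i ℚ.* a ℚ.* b) (⟦⟧-* 2 (2 ^ k)) (⟦⟧-* (suc k) (k !)) ⟩
  E ℚ.* x ℚ.* i ℚ.* (⟦ 2 ⟧ ℚ.* ⟦ 2 ^ k ⟧) ℚ.* (⟦ suc k ⟧ ℚ.* ⟦ k ! ⟧)
    ≡⟨ solve 7 (λ E x i a b c d → E :* x :* i :* (a :* b) :* (c :* d) := (i :* c) :* ((x :* a) :* (E :* b :* d)))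
         refl E x i ⟦ 2 ⟧ ⟦ 2 ^ k ⟧ ⟦ suc k ⟧ ⟦ k ! ⟧ ⟩
  (i ℚ.* ⟦ suc k ⟧) ℚ.* ((x ℚ.* ⟦ 2 ⟧) ℚ.* (E ℚ.* ⟦ 2 ^ k ⟧ ℚ.* ⟦ k ! ⟧))
    ≡⟨ trans (cong (ℚ._* X) (1/suc*⟦suc⟧ k)) (ℚ.*-identityˡ X) ⟩
  (x ℚ.* ⟦ 2 ⟧) ℚ.* (E ℚ.* ⟦ 2 ^ k ⟧ ℚ.* ⟦ k ! ⟧)
    ≤⟨ *-mono-≤ℚ (0≤* 0≤x 0≤⟦ 2 ⟧) 0≤⟦ c ^ k ⟧ 2x≤c (expTerm*2^*!≤ k 0≤x 2x≤c) ⟩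
  ⟦ c ⟧ ℚ.* ⟦ c ^ k ⟧
    ≡⟨ ⟦⟧-* c (c ^ k) ⟨
  ⟦ c ^ suc k ⟧ ∎
  where
  open ℚ.≤-Reasoning
  E = expTerm k x
  i = ℤ.+ 1 ℚ./ suc k
  X = (x ℚ.* ⟦ 2 ⟧) ℚ.* (E ℚ.* ⟦ 2 ^ k ⟧ ℚ.* ⟦ k ! ⟧)

-- The hypothesis bounds the k-th term of the exponential series by b / 2^k.
expPartial≤ : ∀ N {x c b} → 0ℚ ℚ.≤ x → x ℚ.* ⟦ 2 ⟧ ℚ.≤ ⟦ c ⟧ → (∀ k → c ^ k ≤ b * k !) →
  expPartial N x ℚ.≤ ⟦ 2 * b ⟧
expPartial≤ N {x} {c} {b} 0≤x 2x≤c bound = *-cancelʳ-≤ℚ (2 ^ N) {{m^n≢0 2 N}} (begin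
  expPartial N x ℚ.* ⟦ 2 ^ N ⟧                ≡⟨ ℚ.+-identityʳ _ ⟨
  expPartial N x ℚ.* ⟦ 2 ^ N ⟧ ℚ.+ 0ℚ         ≤⟨ ℚ.+-monoʳ-≤ (expPartial N x ℚ.* ⟦ 2 ^ N ⟧) 0≤⟦ b ⟧ ⟩
  expPartial N x ℚ.* ⟦ 2 ^ N ⟧ ℚ.+ ⟦ b ⟧      ≤⟨ geometric N ⟩
  ⟦ 2 * b ⟧ ℚ.* ⟦ 2 ^ N ⟧ ∎)
  where
  open ℚ.≤-Reasoning
  term : ∀ k → expTerm k x ℚ.* ⟦ 2 ^ k ⟧ ℚ.≤ ⟦ b ⟧
  term k = *-cancelʳ-≤ℚ (k !) {{k !≢0}} (begin
    expTerm k x ℚ.* ⟦ 2 ^ k ⟧ ℚ.* ⟦ k ! ⟧     ≤⟨ expTerm*2^*!≤ k 0≤x 2x≤c ⟩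
    ⟦ c ^ k ⟧                                 ≤⟨ ⟦⟧-mono-≤ (bound k) ⟩
    ⟦ b * k ! ⟧                               ≡⟨ ⟦⟧-* b (k !) ⟩
    ⟦ b ⟧ ℚ.* ⟦ k ! ⟧ ∎)
  geometric : ∀ N → expPartial N x ℚ.* ⟦ 2 ^ N ⟧ ℚ.+ ⟦ b ⟧ ℚ.≤ ⟦ 2 * b ⟧ ℚ.* ⟦ 2 ^ N ⟧
  geometric zero = begin
    1ℚ ℚ.* ⟦ 1 ⟧ ℚ.+ ⟦ b ⟧     ≤⟨ ℚ.+-monoˡ-≤ ⟦ b ⟧ (term 0) ⟩
    ⟦ b ⟧ ℚ.+ ⟦ b ⟧            ≡⟨ ⟦⟧-+ b b ⟨
    ⟦ b + b ⟧                  ≡⟨ cong (λ y → ⟦ b + y ⟧) (+-identityʳ b) ⟨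
    ⟦ 2 * b ⟧                  ≡⟨ ℚ.*-identityʳ _ ⟨
    ⟦ 2 * b ⟧ ℚ.* ⟦ 1 ⟧ ∎
  geometric (suc N) = begin
    (P ℚ.+ E) ℚ.* ⟦ 2 ^ suc N ⟧ ℚ.+ ⟦ b ⟧
      ≡⟨ solve 4 (λ P E w b → (P :+ E) :* w :+ b := P :* w :+ (E :* w :+ b)) refl P E ⟦ 2 ^ suc N ⟧ ⟦ b ⟧ ⟩
    P ℚ.* ⟦ 2 ^ suc N ⟧ ℚ.+ (E ℚ.* ⟦ 2 ^ suc N ⟧ ℚ.+ ⟦ b ⟧)
      ≤⟨ ℚ.+-monoʳ-≤ (P ℚ.* ⟦ 2 ^ suc N ⟧) (ℚ.+-monoˡ-≤ ⟦ b ⟧ (term (suc N))) ⟩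
    P ℚ.* ⟦ 2 ^ suc N ⟧ ℚ.+ (⟦ b ⟧ ℚ.+ ⟦ b ⟧)
      ≡⟨ cong (λ y → P ℚ.* y ℚ.+ (⟦ b ⟧ ℚ.+ ⟦ b ⟧)) (⟦⟧-* 2 (2 ^ N)) ⟩
    P ℚ.* (⟦ 2 ⟧ ℚ.* ⟦ 2 ^ N ⟧) ℚ.+ (⟦ b ⟧ ℚ.+ ⟦ b ⟧)
      ≡⟨ solve 3 (λ P w b → P :* (con ⟦ 2 ⟧ :* w) :+ (b :+ b) := con ⟦ 2 ⟧ :* (P :* w :+ b))
           refl P ⟦ 2 ^ N ⟧ ⟦ b ⟧ ⟩
    ⟦ 2 ⟧ ℚ.* (P ℚ.* ⟦ 2 ^ N ⟧ ℚ.+ ⟦ b ⟧)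
      ≤⟨ *-monoʳ-≤ℚ ⟦ 2 ⟧ 0≤⟦ 2 ⟧ (geometric N) ⟩
    ⟦ 2 ⟧ ℚ.* (⟦ 2 * b ⟧ ℚ.* ⟦ 2 ^ N ⟧)
      ≡⟨ solve 3 (λ a b c → a :* (b :* c) := b :* (a :* c)) refl ⟦ 2 ⟧ ⟦ 2 * b ⟧ ⟦ 2 ^ N ⟧ ⟩
    ⟦ 2 * b ⟧ ℚ.* (⟦ 2 ⟧ ℚ.* ⟦ 2 ^ N ⟧)
      ≡⟨ cong (⟦ 2 * b ⟧ ℚ.*_) (⟦⟧-* 2 (2 ^ N)) ⟨
    ⟦ 2 * b ⟧ ℚ.* ⟦ 2 ^ suc N ⟧ ∎
    where
    P = expPartial N x
    E = expTerm (suc N) x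

LogBound⇒≤ : ∀ {n t ℓ c b} → LogBoundLE n t ℓ → ℓ ℚ.* ⟦ 2 ⟧ ℚ.≤ ⟦ c ⟧ → (∀ k → c ^ k ≤ b * k !) →
  n ≤ t * (2 * b)
LogBound⇒≤ {n} {t} {ℓ} {c} {b} (0≤ℓ , N , n≤) 2ℓ≤c bound = ⟦⟧-cancel-≤ (begin
  ⟦ n ⟧                            ≤⟨ n≤ ⟩
  ⟦ t ⟧ ℚ.* expPartial N ℓ         ≤⟨ *-monoʳ-≤ℚ ⟦ t ⟧ 0≤⟦ t ⟧ (expPartial≤ N {b = b} 0≤ℓ 2ℓ≤c bound) ⟩
  ⟦ t ⟧ ℚ.* ⟦ 2 * b ⟧              ≡⟨ ⟦⟧-* t (2 * b) ⟨
  ⟦ t * (2 * b) ⟧ ∎)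
  where open ℚ.≤-Reasoning

-- Let `c < 2ℓ ≤ c+1`. The series bound gives `n ≤ 2 · 4^(c+1) t`, so `2^g < 2^(7+2c)` and
-- `g+1 ≤ 7+2c`. The 7 is absorbed by `1 < 2ℓ`: otherwise the series would be at most 2 and
-- `n ≤ 2t`, against `4t ≤ n`. In total, `7 · 2ℓ + 2 · 2ℓ = 18ℓ`.
log-lower-bound : ∀ {n t ℓ} g .{{_ : NonZero t}} → 4 * t ≤ n → LogBoundLE n t ℓ →
  t * 2 ^ g < 16 * n → ⟦ suc g ⟧ ℚ.≤ ⟦ 18 ⟧ ℚ.* ℓ
log-lower-bound {n} {t} {ℓ} g 4t≤n log g< = begin
  ⟦ suc g ⟧                              ≤⟨ ⟦⟧-mono-≤ g<7+2c ⟩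
  ⟦ 7 + 2 * c ⟧                          ≡⟨ trans (⟦⟧-+ 7 (2 * c)) (cong (⟦ 7 ⟧ ℚ.+_) (⟦⟧-* 2 c)) ⟩
  ⟦ 7 ⟧ ℚ.+ ⟦ 2 ⟧ ℚ.* ⟦ c ⟧              ≤⟨ ℚ.+-mono-≤ (*-monoʳ-≤ℚ ⟦ 7 ⟧ 0≤⟦ 7 ⟧ (ℚ.<⇒≤ (ℚ.≰⇒> ¬1)))
                                              (*-monoʳ-≤ℚ ⟦ 2 ⟧ 0≤⟦ 2 ⟧ (ℚ.<⇒≤ (ℚ.≰⇒> ¬c))) ⟩
  ⟦ 7 ⟧ ℚ.* (ℓ ℚ.* ⟦ 2 ⟧) ℚ.+ ⟦ 2 ⟧ ℚ.* (ℓ ℚ.* ⟦ 2 ⟧)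
    ≡⟨ solve 1 (λ l → con ⟦ 7 ⟧ :* (l :* con ⟦ 2 ⟧) :+ con ⟦ 2 ⟧ :* (l :* con ⟦ 2 ⟧) := con ⟦ 18 ⟧ :* l) refl ℓ ⟩
  ⟦ 18 ⟧ ℚ.* ℓ ∎
  where
  open ℚ.≤-Reasoning
  Above : ℕ → Set
  Above c = ℓ ℚ.* ⟦ 2 ⟧ ℚ.≤ ⟦ c ⟧
  ¬1 : ¬ Above 1
  ¬1 2ℓ≤1 = contradiction
    (≤-trans 4t≤n (LogBound⇒≤ {n} {t} {c = 1} {b = 1} log 2ℓ≤1
      λ k → subst (_≤ 1 * k !) (sym (^-zeroˡ k)) (≤-trans (1≤n! k) (≤-reflexive (sym (*-identityˡ (k !)))))))
    (<⇒≱ (subst (_< 4 * t) (*-comm 2 t) (*-monoˡ-< t {2} {4} (s≤s (s≤s (s≤s z≤n))))))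
  ¬0 : ¬ Above 0
  ¬0 2ℓ≤0 = ¬1 (ℚ.≤-trans 2ℓ≤0 0≤⟦ 1 ⟧)
  search : ∃ λ c → ¬ Above c × Above (suc c)
  search = let (m , above) = archimedean (ℓ ℚ.* ⟦ 2 ⟧) in
    last-failure (λ c → (ℓ ℚ.* ⟦ 2 ⟧) ℚ.≤? ⟦ c ⟧) ¬0 m above
  c = proj₁ search
  ¬c = proj₁ (proj₂ search)
  2ℓ≤1+c = proj₂ (proj₂ search)
  g<7+2c : g < 7 + 2 * c
  g<7+2c = ^-cancelʳ-< 2 (*-cancelˡ-< t _ _ (<-≤-trans g< (≤-trans
    (*-monoʳ-≤ 16 (LogBound⇒≤ {n} {t} {c = suc c} {b = 4 ^ suc c} log 2ℓ≤1+c (^≤4^*! (suc c))))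
    (≤-reflexive (trans (cong (λ y → 16 * (t * (2 * (4 * y)))) (^-*-assoc 2 2 c)) (eq t (2 ^ (2 * c))))))))
    where
    eq : ∀ t y → 16 * (t * (2 * (4 * y))) ≡ t * (2 * (2 * (2 * (2 * (2 * (2 * (2 * y)))))))
    eq = solve-∀

-- The hypothesis on `μ` forces `μ < 256 r`. Rounding up to `suc μ` costs one more, which is
-- absorbed by `1 < r`, a consequence of `s < n`.
pow-lower-bound : ∀ {n s t r} μ .{{_ : NonZero t}} → s < n → PowBoundLE n s t r →
  μ ^ (s ∸ t) * s ^ (2 * t) < 256 ^ (s ∸ t) * n ^ (2 * t) → ⟦ suc μ ⟧ ℚ.≤ ⟦ 257 ⟧ ℚ.* r
pow-lower-bound {n} {s} {t} {r} μ s<n (0≤r , n≤) μ< = begin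
  ⟦ suc μ ⟧                        ≡⟨ ⟦⟧-+ 1 μ ⟩
  1ℚ ℚ.+ ⟦ μ ⟧                     ≤⟨ ℚ.+-mono-≤ (ℚ.<⇒≤ (ℚ.≰⇒> r≰1)) (ℚ.<⇒≤ (ℚ.≰⇒> 256r≰μ)) ⟩
  r ℚ.+ ⟦ 256 ⟧ ℚ.* r              ≡⟨ solve 1 (λ r → r :+ con ⟦ 256 ⟧ :* r := con ⟦ 257 ⟧ :* r) refl r ⟩
  ⟦ 257 ⟧ ℚ.* r ∎
  where
  open ℚ.≤-Reasoning
  d = s ∸ t
  m = 2 * t
  instance
    m≢0 : NonZero m
    m≢0 = m*n≢0 2 t
  r≰1 : ¬ r ℚ.≤ 1ℚ
  r≰1 r≤1 = <⇒≱ s<n (^-cancelˡ-≤ m (⟦⟧-cancel-≤ (begin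
    ⟦ n ^ m ⟧                        ≡⟨ ⟦⟧-^ n m ⟩
    ⟦ n ⟧ ^ℚ m                       ≤⟨ n≤ ⟩
    (r ^ℚ d) ℚ.* (⟦ s ⟧ ^ℚ m)        ≤⟨ *-monoˡ-≤ℚ _ (0≤^ℚ m 0≤⟦ s ⟧) (^ℚ-mono-≤ d 0≤r r≤1) ⟩
    (1ℚ ^ℚ d) ℚ.* (⟦ s ⟧ ^ℚ m)       ≡⟨ cong₂ ℚ._*_ (trans (sym (⟦⟧-^ 1 d)) (cong ⟦_⟧ (^-zeroˡ d))) refl ⟩
    1ℚ ℚ.* (⟦ s ⟧ ^ℚ m)              ≡⟨ ℚ.*-identityˡ _ ⟩
    ⟦ s ⟧ ^ℚ m                       ≡⟨ ⟦⟧-^ s m ⟨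
    ⟦ s ^ m ⟧ ∎)))
  256r≰μ : ¬ ⟦ 256 ⟧ ℚ.* r ℚ.≤ ⟦ μ ⟧
  256r≰μ le = <⇒≱ μ< (⟦⟧-cancel-≤ (begin
    ⟦ 256 ^ d * n ^ m ⟧
      ≡⟨ trans (⟦⟧-* (256 ^ d) (n ^ m)) (cong₂ ℚ._*_ (⟦⟧-^ 256 d) (⟦⟧-^ n m)) ⟩
    (⟦ 256 ⟧ ^ℚ d) ℚ.* (⟦ n ⟧ ^ℚ m)
      ≤⟨ *-monoʳ-≤ℚ _ (0≤^ℚ d 0≤⟦ 256 ⟧) n≤ ⟩
    (⟦ 256 ⟧ ^ℚ d) ℚ.* ((r ^ℚ d) ℚ.* (⟦ s ⟧ ^ℚ m))
      ≡⟨ ℚ.*-assoc (⟦ 256 ⟧ ^ℚ d) (r ^ℚ d) (⟦ s ⟧ ^ℚ m) ⟨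
    (⟦ 256 ⟧ ^ℚ d) ℚ.* (r ^ℚ d) ℚ.* (⟦ s ⟧ ^ℚ m)
      ≡⟨ cong (ℚ._* (⟦ s ⟧ ^ℚ m)) (^ℚ-distrib-* ⟦ 256 ⟧ r d) ⟨
    ((⟦ 256 ⟧ ℚ.* r) ^ℚ d) ℚ.* (⟦ s ⟧ ^ℚ m)
      ≤⟨ *-monoˡ-≤ℚ _ (0≤^ℚ m 0≤⟦ s ⟧) (^ℚ-mono-≤ d (0≤* 0≤⟦ 256 ⟧ 0≤r) le) ⟩
    (⟦ μ ⟧ ^ℚ d) ℚ.* (⟦ s ⟧ ^ℚ m)
      ≡⟨ trans (⟦⟧-* (μ ^ d) (s ^ m)) (cong₂ ℚ._*_ (⟦⟧-^ μ d) (⟦⟧-^ s m)) ⟨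
    ⟦ μ ^ d * s ^ m ⟧ ∎))

BoundBelow⇒< : ∀ {n s t k μ g} .{{_ : NonZero t}} → 4 * t ≤ n → s < n →
  μ ^ (s ∸ t) * s ^ (2 * t) < 256 ^ (s ∸ t) * n ^ (2 * t) → t * 2 ^ g < 16 * n →
  BoundBelow ⟦ 18504 ⟧ n s t k → 4 * t * suc μ * suc g < k
BoundBelow⇒< {n} {s} {t} {k} {μ} {g} 4t≤n s<n μ< g< (r , ℓ , pow , log , below) = ⟦⟧-cancel-< (begin-strict
  ⟦ 4 * t * suc μ * suc g ⟧
    ≡⟨ trans (⟦⟧-* (4 * t * suc μ) (suc g)) (cong (ℚ._* ⟦ suc g ⟧)
         (trans (⟦⟧-* (4 * t) (suc μ)) (cong (ℚ._* ⟦ suc μ ⟧) (⟦⟧-* 4 t)))) ⟩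
  ⟦ 4 ⟧ ℚ.* ⟦ t ⟧ ℚ.* ⟦ suc μ ⟧ ℚ.* ⟦ suc g ⟧
    ≤⟨ *-mono-≤ℚ (0≤* 0≤4t 0≤⟦ suc μ ⟧) (0≤* 0≤⟦ 18 ⟧ (proj₁ log))
         (*-monoʳ-≤ℚ _ 0≤4t (pow-lower-bound μ s<n pow μ<)) (log-lower-bound g 4t≤n log g<) ⟩
  ⟦ 4 ⟧ ℚ.* ⟦ t ⟧ ℚ.* (⟦ 257 ⟧ ℚ.* r) ℚ.* (⟦ 18 ⟧ ℚ.* ℓ)
    ≡⟨ solve 3 (λ t r l → con ⟦ 4 ⟧ :* t :* (con ⟦ 257 ⟧ :* r) :* (con ⟦ 18 ⟧ :* l)
                          := con ⟦ 18504 ⟧ :* t :* r :* l) refl ⟦ t ⟧ r ℓ ⟩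
  ⟦ 18504 ⟧ ℚ.* ⟦ t ⟧ ℚ.* r ℚ.* ℓ
    <⟨ below ⟩
  ⟦ k ⟧ ∎)
  where
  open ℚ.≤-Reasoning
  0≤4t : 0ℚ ℚ.≤ ⟦ 4 ⟧ ℚ.* ⟦ t ⟧
  0≤4t = 0≤* 0≤⟦ 4 ⟧ 0≤⟦ t ⟧

-- First moments

2*triangular≤ : ∀ k → 2 * triangular k ≤ k * k
2*triangular≤ zero    = z≤n
2*triangular≤ (suc k) = begin
  2 * (k + triangular k)       ≡⟨ *-distribˡ-+ 2 k (triangular k) ⟩
  2 * k + 2 * triangular k     ≤⟨ +-monoʳ-≤ (2 * k) (2*triangular≤ k) ⟩
  2 * k + k * k                ≤⟨ n≤1+n _ ⟩
  suc (2 * k + k * k)          ≡⟨ eq k ⟩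
  suc k * suc k ∎
  where
  open ≤-Reasoning
  eq : ∀ k → 1 + (2 * k + k * k) ≡ (1 + k) * (1 + k)
  eq = solve-∀

2*triangular-suc : ∀ k → 2 * triangular (suc k) ≡ suc k * k
2*triangular-suc zero    = refl
2*triangular-suc (suc k) = begin
  2 * (suc k + triangular (suc k))       ≡⟨ *-distribˡ-+ 2 (suc k) (triangular (suc k)) ⟩
  2 * suc k + 2 * triangular (suc k)     ≡⟨ cong (2 * suc k +_) (2*triangular-suc k) ⟩
  2 * suc k + suc k * k                  ≡⟨ eq k ⟩
  suc (suc k) * suc k ∎
  where
  open ≡-Reasoning
  eq : ∀ k → 2 * (1 + k) + (1 + k) * k ≡ (2 + k) * (1 + k)
  eq = solve-∀

triangular-odd : ∀ x → triangular (suc (2 * x)) ≡ suc (2 * x) * x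
triangular-odd x = *-cancelˡ-≡ _ _ 2 (trans (2*triangular-suc (2 * x)) (eq x))
  where
  eq : ∀ x → (1 + 2 * x) * (2 * x) ≡ 2 * ((1 + 2 * x) * x)
  eq = solve-∀

^-swap : ∀ x a b → (x ^ a) ^ b ≡ (x ^ b) ^ a
^-swap x a b = trans (^-*-assoc x a b) (trans (cong (x ^_) (*-comm a b)) (sym (^-*-assoc x b a)))

-- A k-set has `k g q` pairs and is independent with probability at most `2^(-kg)`. There are at
-- most `(4n/k)^k ≤ (4n/t)^k` such sets, and `2^g ≥ 16n/t` leaves `4^(-k) ≤ 1/4`.
edgeless-sets-≤ : ∀ p g n t .{{_ : NonZero p}} .{{_ : NonZero n}} →
  let k = suc (2 * (g * suc p)) in t ≤ k → 16 * n ≤ t * 2 ^ g →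
  4 * ∑ (randomGraph p n) (λ G → subsetSum n k λ T → 0 ^ edges T G) ≤ total (randomGraph p n)
edgeless-sets-≤ p g n t t≤k 16n≤ = begin
  4 * B          ≡⟨ *-comm 4 B ⟩
  B * 4          ≤⟨ *-monoʳ-≤ B (m≤m*n 4 (4 ^ (2 * (g * q))) {{m^n≢0 4 (2 * (g * q))}}) ⟩
  B * 4 ^ k      ≤⟨ B*4^k≤Z ⟩
  Z ∎
  where
  open ≤-Reasoning
  q = suc p
  k = suc (2 * (g * q))
  b = binom n k
  Tr = triangular k
  B = ∑ (randomGraph p n) (λ G → subsetSum n k λ T → 0 ^ edges T G)
  Z = total (randomGraph p n)
  rearrange₁ : ∀ x y z → x * y * z ≡ x * z * y
  rearrange₁ = solve-∀
  rearrange₂ : ∀ x y z → x * (y * z) ≡ x * z * y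
  rearrange₂ = solve-∀
  -- The odd size `k = 2 g q + 1` makes the number of pairs an exact multiple of `q`, so halving per
  -- `q` pairs needs no rounding.
  Tr≡ : q * (k * g) ≡ Tr
  Tr≡ = trans (eq q k g) (sym (triangular-odd (g * q)))
    where
    eq : ∀ q k g → q * (k * g) ≡ k * (g * q)
    eq = solve-∀
  2^*p^≤q^ : 2 ^ (k * g) * p ^ Tr ≤ q ^ Tr
  2^*p^≤q^ = begin
    2 ^ (k * g) * p ^ Tr               ≡⟨ cong (λ e → 2 ^ (k * g) * p ^ e) Tr≡ ⟨
    2 ^ (k * g) * p ^ (q * (k * g))    ≡⟨ cong (2 ^ (k * g) *_) (^-*-assoc p q (k * g)) ⟨
    2 ^ (k * g) * (p ^ q) ^ (k * g)    ≡⟨ ^-distribʳ-* 2 (p ^ q) (k * g) ⟨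
    (2 * p ^ q) ^ (k * g)              ≤⟨ ^-monoˡ-≤ (k * g) (2*-^-≤-suc p) ⟩
    (q ^ q) ^ (k * g)                  ≡⟨ ^-*-assoc q q (k * g) ⟩
    q ^ (q * (k * g))                  ≡⟨ cong (q ^_) Tr≡ ⟩
    q ^ Tr ∎
  B*2^≤b*Z : B * 2 ^ (k * g) ≤ b * Z
  B*2^≤b*Z = *-cancelʳ-≤ _ _ (p ^ Tr) {{m^n≢0 p Tr}} (begin
    B * 2 ^ (k * g) * p ^ Tr           ≡⟨ *-assoc B (2 ^ (k * g)) (p ^ Tr) ⟩
    B * (2 ^ (k * g) * p ^ Tr)         ≤⟨ *-monoʳ-≤ B 2^*p^≤q^ ⟩
    B * q ^ Tr                         ≤⟨ ∑-subsetSum-edges-≤ p 0 n k ⟩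
    b * (p ^ Tr * Z)                   ≡⟨ rearrange₂ b (p ^ Tr) Z ⟩
    b * Z * p ^ Tr ∎)
  4^*^≤ : 4 ^ k * (4 * n) ^ k ≤ 2 ^ (k * g) * k ^ k
  4^*^≤ = begin
    4 ^ k * (4 * n) ^ k        ≡⟨ ^-distribʳ-* 4 (4 * n) k ⟨
    (4 * (4 * n)) ^ k          ≡⟨ cong (_^ k) (*-assoc 4 4 n) ⟨
    (16 * n) ^ k               ≤⟨ ^-monoˡ-≤ k (≤-trans 16n≤ (*-monoˡ-≤ (2 ^ g) t≤k)) ⟩
    (k * 2 ^ g) ^ k            ≡⟨ cong (_^ k) (*-comm k (2 ^ g)) ⟩
    (2 ^ g * k) ^ k            ≡⟨ ^-distribʳ-* (2 ^ g) k k ⟩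
    (2 ^ g) ^ k * k ^ k        ≡⟨ cong (_* k ^ k) (trans (^-*-assoc 2 g k) (cong (2 ^_) (*-comm g k))) ⟩
    2 ^ (k * g) * k ^ k ∎
  B*4^k≤Z : B * 4 ^ k ≤ Z
  B*4^k≤Z = *-cancelʳ-≤ _ _ ((4 * n) ^ k) {{m^n≢0 (4 * n) k {{m*n≢0 4 n}}}} (begin
    B * 4 ^ k * (4 * n) ^ k            ≡⟨ *-assoc B (4 ^ k) ((4 * n) ^ k) ⟩
    B * (4 ^ k * (4 * n) ^ k)          ≤⟨ *-monoʳ-≤ B 4^*^≤ ⟩
    B * (2 ^ (k * g) * k ^ k)          ≡⟨ *-assoc B (2 ^ (k * g)) (k ^ k) ⟨
    B * 2 ^ (k * g) * k ^ k            ≤⟨ *-monoˡ-≤ (k ^ k) B*2^≤b*Z ⟩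
    b * Z * k ^ k                      ≡⟨ rearrange₁ b Z (k ^ k) ⟩
    b * k ^ k * Z                      ≤⟨ *-monoˡ-≤ Z (binom*^≤ n k) ⟩
    (4 * n) ^ k * Z                    ≡⟨ *-comm ((4 * n) ^ k) Z ⟩
    Z * (4 * n) ^ k ∎)

-- Only powers of l, the integer version of 256 (n/s)^(2t/(s-t)), are controlled, so both sides are compared
-- through their 2t-th powers.
binom-suc-^-≤ : ∀ n s t m₀ l .{{_ : NonZero t}} .{{_ : NonZero l}} → 2 * t ≤ s →
  256 ^ (s ∸ t) * n ^ (2 * t) ≤ l ^ (s ∸ t) * s ^ (2 * t) → s * (s ∸ t) ≤ 2 * t * m₀ →
  2 * binom n s * suc (2 * t) ^ triangular s ≤ l ^ m₀ * (2 * t) ^ triangular s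
binom-suc-^-≤ n s t m₀ l 2t≤s pow dense = *-cancelʳ-≤ _ _ (s ^ s) {{m^n≢0 s s}} (begin
  2 * binom n s * suc m ^ Tr * s ^ s     ≡⟨ eq (binom n s) (suc m ^ Tr) (s ^ s) ⟩
  2 * (binom n s * s ^ s) * suc m ^ Tr   ≤⟨ *-monoˡ-≤ (suc m ^ Tr) (*-monoʳ-≤ 2 (binom*^≤ n s)) ⟩
  2 * (4 * n) ^ s * suc m ^ Tr           ≤⟨ ^-cancelˡ-≤ m powers ⟩
  l ^ m₀ * m ^ Tr * s ^ s ∎)
  where
  open ≤-Reasoning
  m = 2 * t
  d = s ∸ t
  Tr = triangular s
  instance
    m≢0 : NonZero m
    m≢0 = m*n≢0 2 t
    s≢0 : NonZero s
    s≢0 = >-nonZero (<-≤-trans (>-nonZero⁻¹ m) 2t≤s)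
  eq : ∀ b x y → 2 * b * x * y ≡ 2 * (b * y) * x
  eq = solve-∀
  t≤s : t ≤ s
  t≤s = ≤-trans (m≤n*m t 2) 2t≤s
  s≤2d : s ≤ 2 * d
  s≤2d = +-cancelʳ-≤ (2 * t) s (2 * d) (begin
    s + 2 * t        ≤⟨ +-monoʳ-≤ s 2t≤s ⟩
    s + s            ≡⟨ cong (s +_) (+-identityʳ s) ⟨
    2 * s            ≡⟨ cong (2 *_) (m∸n+n≡m t≤s) ⟨
    2 * (d + t)      ≡⟨ *-distribˡ-+ 2 d t ⟩
    2 * d + 2 * t ∎)
  exponent : ∀ x → (x ^ Tr) ^ m ≡ (x ^ t) ^ (2 * Tr)
  exponent x = trans (^-*-assoc x Tr m) (trans (cong (x ^_) (comm Tr t)) (sym (^-*-assoc x t (2 * Tr))))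
    where
    comm : ∀ a b → a * (2 * b) ≡ b * (2 * a)
    comm = solve-∀
  n-power : ((4 * n) ^ s) ^ m ≤ 4 ^ (s * s) * (n ^ m) ^ s
  n-power = begin
    ((4 * n) ^ s) ^ m             ≡⟨ cong (_^ m) (^-distribʳ-* 4 n s) ⟩
    (4 ^ s * n ^ s) ^ m           ≡⟨ ^-distribʳ-* (4 ^ s) (n ^ s) m ⟩
    (4 ^ s) ^ m * (n ^ s) ^ m     ≡⟨ cong₂ _*_ (^-*-assoc 4 s m) (^-swap n s m) ⟩
    4 ^ (s * m) * (n ^ m) ^ s     ≤⟨ *-monoˡ-≤ _ (^-monoʳ-≤ 4 (*-monoʳ-≤ s 2t≤s)) ⟩
    4 ^ (s * s) * (n ^ m) ^ s ∎
  -- The factor `(1 + 1/(2t))^Tr`, raised to the power `2t`: the bound `(1 + 1/(2t))^t ≤ 2` is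
  -- applied `2 Tr ≤ s s` times.
  m-power : (suc m ^ Tr) ^ m ≤ 2 ^ (s * s) * (m ^ Tr) ^ m
  m-power = begin
    (suc m ^ Tr) ^ m                          ≡⟨ exponent (suc m) ⟩
    (suc m ^ t) ^ (2 * Tr)                    ≤⟨ ^-monoˡ-≤ (2 * Tr) (suc-^-≤-2* m t (n≤1+n m)) ⟩
    (2 * m ^ t) ^ (2 * Tr)                    ≡⟨ ^-distribʳ-* 2 (m ^ t) (2 * Tr) ⟩
    2 ^ (2 * Tr) * (m ^ t) ^ (2 * Tr)         ≤⟨ *-monoˡ-≤ _ (^-monoʳ-≤ 2 (2*triangular≤ s)) ⟩
    2 ^ (s * s) * (m ^ t) ^ (2 * Tr)          ≡⟨ cong (2 ^ (s * s) *_) (exponent m) ⟨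
    2 ^ (s * s) * (m ^ Tr) ^ m ∎
  -- The origin of 256: the leading factor 2, the 4 of the binomial bound and the 2 of `m-power`
  -- multiply to 16, and `s ≤ 2d` turns the exponent `s s` into `2 d s`, squaring the base.
  constants : 2 ^ (s * s) * 4 ^ (s * s) * 2 ^ (s * s) ≤ (256 ^ d) ^ s
  constants = begin
    2 ^ (s * s) * 4 ^ (s * s) * 2 ^ (s * s)   ≡⟨ cong (_* 2 ^ (s * s)) (^-distribʳ-* 2 4 (s * s)) ⟨
    8 ^ (s * s) * 2 ^ (s * s)                 ≡⟨ ^-distribʳ-* 8 2 (s * s) ⟨
    16 ^ (s * s)                              ≤⟨ ^-monoʳ-≤ 16 (*-monoˡ-≤ s s≤2d) ⟩
    16 ^ (2 * d * s)                          ≡⟨ ^-*-assoc 16 (2 * d) s ⟨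
    (16 ^ (2 * d)) ^ s                        ≡⟨ cong (_^ s) (^-*-assoc 16 2 d) ⟨
    (256 ^ d) ^ s ∎
  l-power : (l ^ d) ^ s ≤ (l ^ m₀) ^ m
  l-power = begin
    (l ^ d) ^ s      ≡⟨ trans (^-*-assoc l d s) (cong (l ^_) (*-comm d s)) ⟩
    l ^ (s * d)      ≤⟨ ^-monoʳ-≤ l dense ⟩
    l ^ (m * m₀)     ≡⟨ trans (cong (l ^_) (*-comm m m₀)) (sym (^-*-assoc l m₀ m)) ⟩
    (l ^ m₀) ^ m ∎
  product-power : ∀ x y z → (x * y * z) ^ m ≡ x ^ m * y ^ m * z ^ m
  product-power x y z = trans (^-distribʳ-* (x * y) z m) (cong (_* z ^ m) (^-distribʳ-* x y m))
  M = (m ^ Tr) ^ m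
  powers : (2 * (4 * n) ^ s * suc m ^ Tr) ^ m ≤ (l ^ m₀ * m ^ Tr * s ^ s) ^ m
  powers = begin
    (2 * (4 * n) ^ s * suc m ^ Tr) ^ m
      ≡⟨ product-power 2 ((4 * n) ^ s) (suc m ^ Tr) ⟩
    2 ^ m * ((4 * n) ^ s) ^ m * (suc m ^ Tr) ^ m
      ≤⟨ *-mono-≤ (*-mono-≤ (^-monoʳ-≤ 2 (≤-trans 2t≤s (m≤m*n s s))) n-power) m-power ⟩
    2 ^ (s * s) * (4 ^ (s * s) * (n ^ m) ^ s) * (2 ^ (s * s) * M)
      ≡⟨ eq₁ (2 ^ (s * s)) (4 ^ (s * s)) ((n ^ m) ^ s) (2 ^ (s * s)) M ⟩
    2 ^ (s * s) * 4 ^ (s * s) * 2 ^ (s * s) * (n ^ m) ^ s * M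
      ≤⟨ *-monoˡ-≤ M (*-monoˡ-≤ ((n ^ m) ^ s) constants) ⟩
    (256 ^ d) ^ s * (n ^ m) ^ s * M
      ≡⟨ cong (_* M) (^-distribʳ-* (256 ^ d) (n ^ m) s) ⟨
    (256 ^ d * n ^ m) ^ s * M
      ≤⟨ *-monoˡ-≤ M (^-monoˡ-≤ s pow) ⟩
    (l ^ d * s ^ m) ^ s * M
      ≡⟨ cong (_* M) (^-distribʳ-* (l ^ d) (s ^ m) s) ⟩
    (l ^ d) ^ s * (s ^ m) ^ s * M
      ≤⟨ *-monoˡ-≤ M (*-mono-≤ l-power (≤-reflexive (^-swap s m s))) ⟩
    (l ^ m₀) ^ m * (s ^ s) ^ m * M
      ≡⟨ eq₂ ((l ^ m₀) ^ m) ((s ^ s) ^ m) M ⟩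
    (l ^ m₀) ^ m * M * (s ^ s) ^ m
      ≡⟨ product-power (l ^ m₀) (m ^ Tr) (s ^ s) ⟨
    (l ^ m₀ * m ^ Tr * s ^ s) ^ m ∎
    where
    eq₁ : ∀ x y z w v → x * (y * z) * (w * v) ≡ x * y * w * z * v
    eq₁ = solve-∀
    eq₂ : ∀ x y z → x * y * z ≡ x * z * y
    eq₂ = solve-∀

-- The reason for `q = 2 t l`: each pair contributes `(l+p)/q ≤ (2t+1) l / (2 t l) = 1 +
-- 1/(2t)`, so `l` disappears from the expected weight of a set while a bad set still weighs
-- `l ^ m₀` or more.
dense-sets-≤ : ∀ p n s t m₀ l .{{_ : NonZero t}} .{{_ : NonZero l}} → suc p ≡ 2 * t * l → 2 * t ≤ s →
  256 ^ (s ∸ t) * n ^ (2 * t) ≤ l ^ (s ∸ t) * s ^ (2 * t) → s * (s ∸ t) ≤ 2 * t * m₀ →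
  2 * ∑ (randomGraph p n) (λ G → subsetSum n s λ T → l ^ edges T G) ≤ l ^ m₀ * total (randomGraph p n)
dense-sets-≤ p n s t m₀ l 1+p≡ 2t≤s pow dense = *-cancelʳ-≤ _ _ (m ^ Tr) {{m^n≢0 m Tr {{m*n≢0 2 t}}}} (begin
  2 * A * m ^ Tr                       ≡⟨ *-assoc 2 A (m ^ Tr) ⟩
  2 * (A * m ^ Tr)                     ≤⟨ *-monoʳ-≤ 2 A*m^≤ ⟩
  2 * (b * (suc m ^ Tr * Z))           ≡⟨ eq₁ b (suc m ^ Tr) Z ⟩
  2 * b * suc m ^ Tr * Z               ≤⟨ *-monoˡ-≤ Z (binom-suc-^-≤ n s t m₀ l 2t≤s pow dense) ⟩
  l ^ m₀ * m ^ Tr * Z                  ≡⟨ eq₂ (l ^ m₀) (m ^ Tr) Z ⟩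
  l ^ m₀ * Z * m ^ Tr ∎)
  where
  open ≤-Reasoning
  m = 2 * t
  b = binom n s
  Tr = triangular s
  A = ∑ (randomGraph p n) (λ G → subsetSum n s λ T → l ^ edges T G)
  Z = total (randomGraph p n)
  eq₁ : ∀ x y z → 2 * (x * (y * z)) ≡ 2 * x * y * z
  eq₁ = solve-∀
  eq₂ : ∀ x y z → x * y * z ≡ x * z * y
  eq₂ = solve-∀
  l+p≤ : l + p ≤ suc m * l
  l+p≤ = +-monoʳ-≤ l (≤-trans (n≤1+n p) (≤-reflexive 1+p≡))
  A*m^≤ : A * m ^ Tr ≤ b * (suc m ^ Tr * Z)
  A*m^≤ = *-cancelʳ-≤ _ _ (l ^ Tr) {{m^n≢0 l Tr}} (begin
    A * m ^ Tr * l ^ Tr                ≡⟨ *-assoc A (m ^ Tr) (l ^ Tr) ⟩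
    A * (m ^ Tr * l ^ Tr)              ≡⟨ cong (A *_) (^-distribʳ-* m l Tr) ⟨
    A * (m * l) ^ Tr                   ≡⟨ cong (λ q → A * q ^ Tr) 1+p≡ ⟨
    A * suc p ^ Tr                     ≤⟨ ∑-subsetSum-edges-≤ p l n s ⟩
    b * ((l + p) ^ Tr * Z)             ≤⟨ *-monoʳ-≤ b (*-monoˡ-≤ Z (^-monoˡ-≤ Tr l+p≤)) ⟩
    b * ((suc m * l) ^ Tr * Z)         ≡⟨ cong (λ x → b * (x * Z)) (^-distribʳ-* (suc m) l Tr) ⟩
    b * (suc m ^ Tr * l ^ Tr * Z)      ≡⟨ eq₃ b (suc m ^ Tr) (l ^ Tr) Z ⟩
    b * (suc m ^ Tr * Z) * l ^ Tr ∎)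
    where
    eq₃ : ∀ b x y z → b * (x * y * z) ≡ b * (x * z) * y
    eq₃ = solve-∀

-- Markov's inequality for both expectations at once: X is 0 or at least 1, so M X + Y < M forces X = 0 and Y < M.
both-rare⇒∃ : ∀ {A} (μ : Measure A) (X Y : A → ℕ) M .{{_ : NonZero M}} → total μ > 0 →
  4 * ∑ μ X ≤ total μ → 2 * ∑ μ Y ≤ M * total μ → ∃ λ a → X a ≡ 0 × Y a < M
both-rare⇒∃ μ X Y M Z>0 few-X few-Y =
  -- The hypotheses bound the mean of `M X + Y` by `M/4 + M/2 < M`.
  let (a , lt) = ∑-< μ (λ a → M * X a + Y a) (λ _ → M * 1) (*-cancelˡ-< 4 _ _ (begin-strict
        4 * ∑ μ (λ a → M * X a + Y a)
          ≡⟨ cong (4 *_) (trans (∑-+ μ _ Y) (cong (_+ ∑ μ Y) (∑-*ˡ μ M X))) ⟩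
        4 * (M * ∑ μ X + ∑ μ Y)
          ≡⟨ eq₁ M (∑ μ X) (∑ μ Y) ⟩
        M * (4 * ∑ μ X) + 2 * (2 * ∑ μ Y)
          ≤⟨ +-mono-≤ (*-monoʳ-≤ M few-X) (*-monoʳ-≤ 2 few-Y) ⟩
        M * Z + 2 * (M * Z)
          <⟨ m<n+m _ (*-mono-≤ (>-nonZero⁻¹ M) Z>0) ⟩
        M * Z + (M * Z + 2 * (M * Z))
          ≡⟨ cong (4 *_) (∑-*ˡ μ M (λ _ → 1)) ⟨
        4 * ∑ μ (λ _ → M * 1) ∎))
      small = subst (M * X a + Y a <_) (*-identityʳ M) lt
  in a , X≡0 (X a) (≤-<-trans (m≤m+n _ _) small) , ≤-<-trans (m≤n+m _ _) small
  where
  open ≤-Reasoning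
  Z = total μ
  eq₁ : ∀ m x y → 4 * (m * x + y) ≡ m * (4 * x) + 2 * (2 * y)
  eq₁ = solve-∀
  X≡0 : ∀ x → M * x < M → x ≡ 0
  X≡0 zero    _  = refl
  X≡0 (suc x) lt = contradiction lt (≤⇒≯ (m≤m*n M (suc x)))

-- 18504 = 4 · 257 · 18: the independence number is at most 4 t l g, where l ≤ 257 (n/s)^(2t/(s-t)) and
-- g ≤ 18 log(n/t).
theorem2p3 : ∃ λ (C : ℚ) → (0ℚ ℚ.< C) × ∃ λ (t₀ : ℕ) →
    ∀ (t : ℕ) → t₀ ≤ t → 0 < t → ∃ λ (n₀ : ℕ) →
    ∀ (s n : ℕ) → 2 * t ≤ s → 2 * s ≤ n → n₀ ≤ n →
    Σ (Graph n) λ G → AlphaBound C n s t G × EverySSetHasIndepT G s t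
theorem2p3 = ⟦ 18504 ⟧ , ⟦⟧-mono-< {0} {18504} (s≤s z≤n) , 0 , λ t _ 0<t → 0 , λ s n 2t≤s 2s≤n _ →
  construct t s n {{>-nonZero 0<t}} 2t≤s 2s≤n
  where
  construct : ∀ t s n .{{_ : NonZero t}} → 2 * t ≤ s → 2 * s ≤ n →
    Σ (Graph n) λ G → AlphaBound ⟦ 18504 ⟧ n s t G × EverySSetHasIndepT G s t
  construct t s n 2t≤s 2s≤n = graph G , alpha , few-edges⇒independent s t l m₀ G dense few
    where
    d = s ∸ t
    m = 2 * t
    instance
      m≢0 : NonZero m
      m≢0 = m*n≢0 2 t
      s≢0 : NonZero s
      s≢0 = >-nonZero (<-≤-trans (>-nonZero⁻¹ m) 2t≤s)
      n≢0 : NonZero n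
      n≢0 = >-nonZero (<-≤-trans (>-nonZero⁻¹ (2 * s) {{m*n≢0 2 s}}) 2s≤n)
    t<s : t < s
    t<s = <-≤-trans (m<m+n t (subst (0 <_) (sym (+-identityʳ t)) (>-nonZero⁻¹ t))) 2t≤s
    instance
      d≢0 : NonZero d
      d≢0 = >-nonZero (m<n⇒0<n∸m t<s)
    s<n : s < n
    s<n = <-≤-trans (m<m+n s (subst (0 <_) (sym (+-identityʳ s)) (>-nonZero⁻¹ s))) 2s≤n
    4t≤n : 4 * t ≤ n
    4t≤n = ≤-trans (≤-reflexive (*-assoc 2 2 t)) (≤-trans (*-monoʳ-≤ 2 2t≤s) 2s≤n)

    scale : ∃ λ μ → ¬ 256 ^ d * n ^ m ≤ μ ^ d * s ^ m × 256 ^ d * n ^ m ≤ suc μ ^ d * s ^ m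
    scale = last-failure (λ l → 256 ^ d * n ^ m ≤? l ^ d * s ^ m) fails (256 * n ^ m) holds
      where
      fails : ¬ 256 ^ d * n ^ m ≤ 0 ^ d * s ^ m
      fails le = contradiction (≤-trans le (≤-reflexive (cong (_* s ^ m) (zero-^ d))))
        (<⇒≱ (*-mono-≤ (m^n>0 256 d) (m^n>0 n m)))
        where
        zero-^ : ∀ k .{{_ : NonZero k}} → 0 ^ k ≡ 0
        zero-^ (suc k) = refl
      holds : 256 ^ d * n ^ m ≤ (256 * n ^ m) ^ d * s ^ m
      holds = begin
        256 ^ d * n ^ m                  ≡⟨ cong (256 ^ d *_) (^-identityʳ (n ^ m)) ⟨
        256 ^ d * (n ^ m) ^ 1            ≤⟨ *-monoʳ-≤ (256 ^ d) (^-monoʳ-≤ (n ^ m) {{m^n≢0 n m}} (>-nonZero⁻¹ d)) ⟩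
        256 ^ d * (n ^ m) ^ d            ≡⟨ ^-distribʳ-* 256 (n ^ m) d ⟨
        (256 * n ^ m) ^ d                ≤⟨ m≤m*n _ (s ^ m) {{m^n≢0 s m}} ⟩
        (256 * n ^ m) ^ d * s ^ m ∎
        where open ≤-Reasoning
    μ = proj₁ scale
    l = suc μ

    logarithm : ∃ λ g → ¬ 16 * n ≤ t * 2 ^ g × 16 * n ≤ t * 2 ^ suc g
    logarithm = last-failure (λ g → 16 * n ≤? t * 2 ^ g) fails (16 * n)
      (≤-trans (n≤2^n (16 * n)) (m≤n*m _ t))
      where
      fails : ¬ 16 * n ≤ t * 1
      fails le = <⇒≱ (<-≤-trans (<-trans t<s s<n) (m≤n*m n 16)) (≤-trans le (≤-reflexive (*-identityʳ t)))
    g = suc (proj₁ logarithm)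

    -- `m₀` is `s(s-t)/2t` rounded up: failure one step below makes it a lower bound for the integer
    -- number of edges, success is what the first moment consumes.
    threshold : ∃ λ e → ¬ s * d ≤ m * e × s * d ≤ m * suc e
    threshold = last-failure (λ e → s * d ≤? m * e) fails (s * d) (m≤n*m (s * d) m)
      where
      fails : ¬ s * d ≤ m * 0
      fails le = <⇒≱ (>-nonZero⁻¹ (s * d) {{m*n≢0 s d}}) (≤-trans le (≤-reflexive (*-zeroʳ m)))
    m₀ = suc (proj₁ threshold)
    dense : ∀ e → s * s ≤ 2 * t * e + s * t → m₀ ≤ e
    dense e le = ≰⇒> λ e≤ → proj₁ (proj₂ threshold) (≤-trans s*d≤ (*-monoʳ-≤ m e≤))
      where
      open ≤-Reasoning
      s*d≤ : s * d ≤ m * e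
      s*d≤ = +-cancelʳ-≤ (s * t) _ _ (begin
        s * d + s * t      ≡⟨ *-distribˡ-+ s d t ⟨
        s * (d + t)        ≡⟨ cong (s *_) (m∸n+n≡m (<⇒≤ t<s)) ⟩
        s * s              ≤⟨ le ⟩
        m * e + s * t ∎)

    q = m * l
    p = pred q
    1+p≡q : suc p ≡ q
    1+p≡q = suc-pred q {{m*n≢0 m l}}
    instance
      -- Here `q ≥ 2`, because `m ≥ 2` and `l ≥ 1`; the bound for independent sets cancels a power
      -- of `p`.
      p≢0 : NonZero p
      p≢0 = >-nonZero (s≤s⁻¹ (≤-trans (*-mono-≤ {2} {m} (*-monoʳ-≤ 2 (>-nonZero⁻¹ t)) (s≤s {0} {μ} z≤n))
                                (≤-reflexive (sym 1+p≡q))))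
    k = suc (2 * (g * suc p))
    t≤k : t ≤ k
    t≤k = begin
      t                      ≤⟨ m≤n*m t 2 ⟩
      m                      ≤⟨ m≤m*n m l ⟩
      q                      ≡⟨ 1+p≡q ⟨
      suc p                  ≤⟨ m≤n*m (suc p) g ⟩
      g * suc p              ≤⟨ m≤n*m (g * suc p) 2 ⟩
      2 * (g * suc p)        ≤⟨ n≤1+n _ ⟩
      k ∎
      where open ≤-Reasoning

    good : ∃ λ G → subsetSum n k (λ T → 0 ^ edges T G) ≡ 0 × subsetSum n s (λ T → l ^ edges T G) < l ^ m₀
    good = both-rare⇒∃ (randomGraph p n) _ _ (l ^ m₀) {{m^n≢0 l m₀}} (total-randomGraph>0 p n)
      (edgeless-sets-≤ p g n t t≤k (proj₂ (proj₂ logarithm)))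
      (dense-sets-≤ p n s t m₀ l 1+p≡q 2t≤s (proj₂ (proj₂ scale)) (proj₂ (proj₂ threshold)))
    G = proj₁ good
    few = proj₂ (proj₂ good)

    alpha : AlphaBound ⟦ 18504 ⟧ n s t (graph G)
    alpha I ind below = <⇒≱
      (BoundBelow⇒< 4t≤n s<n (≰⇒> (proj₁ (proj₂ scale))) (≰⇒> (proj₁ (proj₂ logarithm))) below)
      -- `∣ I ∣ < k` means `∣ I ∣ ≤ 2 g q = 4 t l g`, the very number that `below` puts strictly
      -- under `∣ I ∣`.
      (≤-trans (s≤s⁻¹ (no-edgeless-k-set k G (proj₁ (proj₂ good)) I ind))
        (≤-reflexive (trans (cong (λ x → 2 * (g * x)) 1+p≡q) (eq t l g))))
      where
      eq : ∀ t l g → 2 * (g * (2 * t * l)) ≡ 4 * t * l * g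
      eq = solve-∀
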